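{- Let $K\ge1$ and $T\ge0$ be integers and $0<p<1/2$. In the non-adaptive sampling setting for computing $\mathsf{OR}$ from noisy queries, in which the sampling procedure is restricted to taking independent samples from a sequence of distributions $p_1,\dots,p_T$ fixed in advance, $$\inf_{\hat\mu}\ \sup_{\theta\in\{0,1\}^K}\ \mathbb{P}\big(\hat\mu\ne\mathsf{OR}(\theta)\big)\ \ge\ \frac12\left(1-\sqrt{\frac{1}{2K}\left(\Big(1+\frac{(1-2p)^2}{K(1-p)p}\Big)^{T}-1\right)}\right),$$ where the infimum is over all non-adaptive algorithms making $T$ queries. Consequently, the query complexity is at least $\Omega\left(\max\left(K,\frac{K\log(K)\,p}{1-H(p)}\right)\right)$; that is, there is a universal constant $c>0$ such that for all $K\ge1$, $p\in(0,1/2)$ and $\delta\in(0,0.49)$, any non-adaptive algorithm making $T$ queries with $\sup_{\theta}\mathbb{P}(\hat\mu\ne\mathsf{OR}(\theta))\le\delta$ satisfies $T\ge c\max\left(K,\frac{K\log(K)\,p}{1-H(p)}\right)$.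
   Context: For $\theta=(\theta_1,\dots,\theta_K)\in\{0,1\}^K$, $\mathsf{OR}(\theta)=1$ if some $\theta_k=1$ and $\mathsf{OR}(\theta)=0$ otherwise. The sequence $\theta$ is unknown. One query consists of choosing an index $k\in[K]=\{1,\dots,K\}$ and observing $\theta_k$ passed through a binary symmetric channel with flip probability $p$: the observation equals $\theta_k$ with probability $1-p$ and $1-\theta_k$ with probability $p$, with noise independent across queries. A non-adaptive algorithm $\hat\mu$ with $T$ queries fixes, before any observation, probability distributions $p_1,\dots,p_T$ on $[K]$; the index queried in round $t$ is drawn from $p_t$, independently across rounds and of all observations. After $T$ rounds it outputs a (possibly random) value in $\{0,1\}$, also denoted $\hat\mu$, based on all queried indices and observations; the flip probability $p$ is known. $\mathbb{P}$ is over the observation noise and the algorithm's randomness when the truth is $\theta$. Notation: $\log$ is natural; $H(p)=-p\log_2p-(1-p)\log_2(1-p)$ is the binary entropy in bits. -}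

module Defs where

open import Level using (Level; _⊔_) renaming (suc to lsuc)
open import Algebra.Bundles using (CommutativeRing; Semiring)
import Algebra.Definitions.RawSemiring as RawSemiringDefs
import Algebra.Properties.Ring as RingProperties
import Algebra.Solver.Ring.NaturalCoefficients.Default as SemiringSolver
open import Data.Bool.Base using (Bool; true; false; if_then_else_; _∨_; _xor_)
open import Data.Fin.Base using (Fin)
open import Data.Nat.Base as ℕ using (ℕ; zero; suc; NonZero)
import Data.Nat.Properties as ℕₚ
open import Data.Product.Base using (∃-syntax; _×_; _,_; proj₁; proj₂)
open import Data.Sum.Base using (_⊎_; inj₁; inj₂)
open import Data.Vec.Base as Vec using (Vec; []; _∷_; lookup)
open import Relation.Nullary using (¬_)
open import Relation.Binary.Core using (Rel)
open import Relation.Binary.Definitions using (Cotransitive)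
open import Relation.Binary.Structures using (IsStrictPartialOrder)
open import Relation.Binary.Lattice.Definitions using (Supremum)

------------------------------------------------------------------------
-- The real numbers

-- The standard library has no real numbers, so they are given by axioms.
-- The axioms are read constructively (as in the HoTT book, §11.2): the
-- Bishop reals satisfy them, and classically the only model up to
-- isomorphism is ℝ.

record OrderedField (c ℓ : Level) : Set (lsuc (c ⊔ ℓ)) where
  field
    commutativeRing : CommutativeRing c ℓ

  open CommutativeRing commutativeRing public
  open RawSemiringDefs (Semiring.rawSemiring semiring) public using (_^_; sum; product)
    renaming (_×_ to _×ₙ_)

  infix 4 _<_ _≤_
  infixl 6 _⊔ʳ_
  infix 8 _⁻¹[_]

  field
    _<_ : Rel Carrier ℓ

  _≤_ : Rel Carrier ℓ
  x ≤ y = ¬ (y < x)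

  field
    isStrictPartialOrder : IsStrictPartialOrder _≈_ _<_
    <-cotrans  : Cotransitive _<_
    ≤-antisym  : ∀ {x y} → x ≤ y → y ≤ x → x ≈ y
    0<1        : 0# < 1#
    +-monoˡ-<  : ∀ z {x y} → x < y → x + z < y + z
    *-monoˡ-<  : ∀ {z} → 0# < z → ∀ {x y} → x < y → x * z < y * z
    *-cancelʳ-< : ∀ {z} → 0# < z → ∀ {x y} → x * z < y * z → x < y

    -- Inverses of negative elements are then - ((- x) ⁻¹).
    _⁻¹[_]     : ∀ x → 0# < x → Carrier
    ⁻¹-inverse : ∀ x (0<x : 0# < x) → x * x ⁻¹[ 0<x ] ≈ 1#

    -- The maximum of two elements.
    _⊔ʳ_       : Carrier → Carrier → Carrier
    ⊔ʳ-supremum : Supremum _≤_ _⊔ʳ_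

  infixl 7 _/_[_]

  _/_[_] : Carrier → ∀ y → 0# < y → Carrier
  x / y [ 0<y ] = x * y ⁻¹[ 0<y ]

  ι : ℕ → Carrier
  ι n = n ×ₙ 1#

  ∣_∣ : Carrier → Carrier
  ∣ x ∣ = x ⊔ʳ - x

  Cauchy : (ℕ → Carrier) → Set (c ⊔ ℓ)
  Cauchy s = ∀ ε → 0# < ε → ∃[ N ] ∀ m n → N ℕ.≤ m → N ℕ.≤ n → ∣ s m - s n ∣ < ε

  infix 4 _⟶_
  _⟶_ : (ℕ → Carrier) → Carrier → Set (c ⊔ ℓ)
  s ⟶ l = ∀ ε → 0# < ε → ∃[ N ] ∀ n → N ℕ.≤ n → ∣ s n - l ∣ < ε

  open IsStrictPartialOrder isStrictPartialOrder public
    using (<-respʳ-≈; <-respˡ-≈)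
    renaming (irrefl to <-irrefl; trans to <-trans; asym to <-asym)

  0<+ : ∀ {x y} → 0# < x → 0# < y → 0# < x + y
  0<+ {x} {y} 0<x 0<y =
    <-trans 0<y (<-respˡ-≈ (+-identityˡ y) (+-monoˡ-< y 0<x))

  0<* : ∀ {x y} → 0# < x → 0# < y → 0# < x * y
  0<* {x} {y} 0<x 0<y = <-respˡ-≈ (zeroˡ y) (*-monoˡ-< 0<y 0<x)

  0<^ : ∀ {x} → 0# < x → ∀ n → 0# < x ^ n
  0<^ 0<x zero    = 0<1
  0<^ 0<x (suc n) = 0<* 0<x (0<^ 0<x n)

  <⇒0<- : ∀ {x y} → x < y → 0# < y - x
  <⇒0<- {x} x<y = <-respˡ-≈ (-‿inverseʳ x) (+-monoˡ-< (- x) x<y)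

  0<ι : ∀ n .{{_ : NonZero n}} → 0# < ι n
  0<ι (suc zero)    = <-respʳ-≈ (sym (+-identityʳ 1#)) 0<1
  0<ι (suc (suc n)) = 0<+ 0<1 (0<ι (suc n))

  0<⁻¹ : ∀ x (0<x : 0# < x) → 0# < x ⁻¹[ 0<x ]
  0<⁻¹ x 0<x = *-cancelʳ-< 0<x
    (<-respˡ-≈ (sym (zeroˡ x))
      (<-respʳ-≈ (sym (trans (*-comm _ _) (⁻¹-inverse x 0<x))) 0<1))

  ½ : Carrier
  ½ = 1# / ι 2 [ 0<ι 2 ]

  0<½ : 0# < ½
  0<½ = 0<* 0<1 (0<⁻¹ (ι 2) (0<ι 2))

  ½+½≈1 : ½ + ½ ≈ 1#
  ½+½≈1 = trans (+-cong (*-identityˡ _) (*-identityˡ _))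
    (trans (solve 1 (λ h → h :+ h := (con 1 :+ (con 1 :+ con 0)) :* h) refl _)
           (⁻¹-inverse (ι 2) (0<ι 2)))
    where open SemiringSolver commutativeSemiring

  ½<1 : ½ < 1#
  ½<1 = <-respˡ-≈ (+-identityˡ ½) (<-respʳ-≈ ½+½≈1 (+-monoˡ-< ½ 0<½))

record Reals (c ℓ : Level) : Set (lsuc (c ⊔ ℓ)) where
  field
    orderedField : OrderedField c ℓ

  open OrderedField orderedField public

  -- exp y = lim (1 + y/n)ⁿ
  expApprox : Carrier → ℕ → Carrier
  expApprox y n = (1# + y / ι (suc n) [ 0<ι (suc n) ]) ^ suc n

  Exp : Carrier → Carrier → Set (c ⊔ ℓ)
  Exp y x = expApprox y ⟶ x

  field
    archimedean : ∀ x → ∃[ n ] x < ι n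
    complete    : ∀ s → Cauchy s → ∃[ l ] s ⟶ l

    -- The specifications below determine √ on the non-negative elements
    -- and log on the positive ones, and by completeness such elements
    -- exist.  Nothing is said about √ of a negative element.
    √        : Carrier → Carrier
    √-nonneg : ∀ {x} → 0# ≤ x → 0# ≤ √ x
    √-square : ∀ {x} → 0# ≤ x → √ x * √ x ≈ x
    log      : ∀ x → 0# < x → Carrier
    exp-log  : ∀ x (0<x : 0# < x) → Exp (log x 0<x) x

------------------------------------------------------------------------
-- log 2 is positive, so that one may divide by it

module Log2 {c ℓ} (ℝ : Reals c ℓ) where
  open Reals ℝ
  open SemiringSolver commutativeSemiring

  <⇒≤ : ∀ {x y} → x < y → x ≤ y
  <⇒≤ x<y y<x = <-asym x<y y<x

  ≤-refl : ∀ {x} → x ≤ x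
  ≤-refl = <-irrefl refl

  ≤-trans : ∀ {x y z} → x ≤ y → y ≤ z → x ≤ z
  ≤-trans {x} {y} {z} x≤y y≤z z<x with <-cotrans z<x y
  ... | inj₁ z<y = y≤z z<y
  ... | inj₂ y<x = x≤y y<x

  <-≤-trans : ∀ {x y z} → x < y → y ≤ z → x < z
  <-≤-trans {x} {y} {z} x<y y≤z with <-cotrans x<y z
  ... | inj₁ x<z = x<z
  ... | inj₂ z<y with () ← y≤z z<y

  ≤-respʳ-≈ : ∀ {x y z} → y ≈ z → x ≤ y → x ≤ z
  ≤-respʳ-≈ y≈z x≤y z<x = x≤y (<-respˡ-≈ (sym y≈z) z<x)

  ≤-respˡ-≈ : ∀ {x y z} → y ≈ z → y ≤ x → z ≤ x
  ≤-respˡ-≈ y≈z y≤x x<z = y≤x (<-respʳ-≈ (sym y≈z) x<z)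

  +-monoˡ-≤ : ∀ z {x y} → x ≤ y → x + z ≤ y + z
  +-monoˡ-≤ z {x} {y} x≤y y+z<x+z =
    x≤y (<-respˡ-≈ (cancel y) (<-respʳ-≈ (cancel x) (+-monoˡ-< (- z) y+z<x+z)))
    where
    cancel : ∀ w → (w + z) - z ≈ w
    cancel w = trans (+-assoc w z (- z))
                 (trans (+-congˡ (-‿inverseʳ z)) (+-identityʳ w))

  +-monoʳ-≤ : ∀ z {x y} → x ≤ y → z + x ≤ z + y
  +-monoʳ-≤ z x≤y = ≤-respˡ-≈ (+-comm _ _) (≤-respʳ-≈ (+-comm _ _) (+-monoˡ-≤ z x≤y))

  *-monoˡ-≤ : ∀ {z} → 0# < z → ∀ {x y} → x ≤ y → x * z ≤ y * z
  *-monoˡ-≤ 0<z x≤y yz<xz = x≤y (*-cancelʳ-< 0<z yz<xz)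

  *-monoʳ-≤ : ∀ {z} → 0# < z → ∀ {x y} → x ≤ y → z * x ≤ z * y
  *-monoʳ-≤ 0<z x≤y = ≤-respˡ-≈ (*-comm _ _) (≤-respʳ-≈ (*-comm _ _) (*-monoˡ-≤ 0<z x≤y))

  ι-mono : ∀ {m n} → m ℕ.≤ n → ι m ≤ ι n
  ι-mono (ℕ.z≤n {zero})  = ≤-refl
  ι-mono (ℕ.z≤n {suc n}) = <⇒≤ (0<ι (suc n))
  ι-mono (ℕ.s≤s m≤n)     = +-monoʳ-≤ 1# (ι-mono m≤n)

  -x≤∣x∣ : ∀ x → - x ≤ ∣ x ∣
  -x≤∣x∣ x = proj₁ (proj₂ (⊔ʳ-supremum x (- x)))

  -- With δ + δ = η and k η ≤ 1: if b ≤ 1 + δ then bᵏ ≤ 1 + k η.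
  ^-bound : ∀ {b δ η} → 0# < b → 0# < δ → δ + δ ≈ η → b ≤ 1# + δ →
            ∀ k → ι k * η ≤ 1# → b ^ k ≤ 1# + ι k * η
  ^-bound {b} {δ} {η} 0<b 0<δ 2δ≈η b≤ zero _ =
    ≤-respʳ-≈ (sym (trans (+-congˡ (zeroˡ η)) (+-identityʳ 1#))) ≤-refl
  ^-bound {b} {δ} {η} 0<b 0<δ 2δ≈η b≤ (suc k) k+1≤ =
    ≤-trans (*-monoʳ-≤ 0<b (^-bound 0<b 0<δ 2δ≈η b≤ k kη≤1))
      (≤-trans (*-monoˡ-≤ 0<1+kη b≤)
        (≤-respˡ-≈ (sym expand) (≤-respʳ-≈ collect
          (+-monoʳ-≤ _ (≤-respʳ-≈ (*-identityʳ δ) (*-monoʳ-≤ 0<δ kη≤1))))))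
    where
    0<η : 0# < η
    0<η = <-respʳ-≈ 2δ≈η (0<+ 0<δ 0<δ)

    kη≤1 : ι k * η ≤ 1#
    kη≤1 = ≤-trans (*-monoˡ-≤ 0<η (ι-mono (ℕₚ.n≤1+n k))) k+1≤

    0<1+kη : 0# < 1# + ι k * η
    0<1+kη = <-≤-trans 0<1 (≤-respˡ-≈ (+-identityʳ 1#) (+-monoʳ-≤ 1#
      (≤-respˡ-≈ (zeroˡ η) (*-monoˡ-≤ 0<η (ι-mono (ℕ.z≤n {k}))))))

    expand : (1# + δ) * (1# + ι k * η) ≈ (1# + δ + ι k * η) + δ * (ι k * η)
    expand = solve 2 (λ d e → (con 1 :+ d) :* (con 1 :+ e)
                                := (con 1 :+ d :+ e) :+ d :* e) refl δ (ι k * η)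

    collect : (1# + δ + ι k * η) + δ ≈ 1# + ι (suc k) * η
    collect = trans
      (solve 2 (λ d e → (con 1 :+ d :+ e) :+ d := con 1 :+ ((d :+ d) :+ e)) refl δ (ι k * η))
      (+-congˡ (trans (+-congʳ 2δ≈η)
        (solve 2 (λ e i → e :+ i :* e := (con 1 :+ i) :* e) refl η (ι k))))

  -- If y < 1/4 then (1 + y/m)ᵐ ≤ 1 + 1/2 for m > - y; u stands for 1/m.
  approx-≤ : ∀ {y u} m → ι m * u ≈ 1# → 0# < u → - y < ι m → y ≤ ½ * ½ →
             (1# + y * u) ^ m ≤ 1# + ½
  approx-≤ {y} {u} m mu≈1 0<u -y<m y≤¼ = ≤-respʳ-≈ (+-congˡ mη≈½)
    (^-bound 0<b (0<* (0<* 0<½ 0<½) 0<u) halves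
      (+-monoʳ-≤ 1# (*-monoˡ-≤ 0<u y≤¼))
      m (≤-respˡ-≈ (sym mη≈½) (<⇒≤ ½<1)))
    where
    0<b : 0# < 1# + y * u
    0<b = <-respʳ-≈ (trans (distribʳ u (ι m) y) (+-congʳ mu≈1))
      (0<* (<-respˡ-≈ (-‿inverseˡ y) (+-monoˡ-< y -y<m)) 0<u)

    halves : (½ * ½) * u + (½ * ½) * u ≈ ½ * u
    halves = trans (sym (distribʳ u (½ * ½) (½ * ½)))
      (*-congʳ (trans (sym (distribʳ ½ ½ ½)) (trans (*-congʳ ½+½≈1) (*-identityˡ ½))))

    mη≈½ : ι m * (½ * u) ≈ ½
    mη≈½ = trans (sym (*-assoc (ι m) ½ u)) (trans (*-congʳ (*-comm (ι m) ½))
      (trans (*-assoc ½ (ι m) u) (trans (*-congˡ mu≈1) (*-identityʳ ½))))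

  close⇒< : ∀ {a e l} x → a + e ≈ l → ∣ x - l ∣ < e → a < x
  close⇒< {a} {e} {l} x a+e≈l close = <-respʳ-≈ (cancel x) (<-respˡ-≈ (cancel a)
      (+-monoˡ-< (- e) (<-respˡ-≈ (sym a+e≈l) (<-respʳ-≈ (+-comm e x)
        (<-respˡ-≈ shift (+-monoˡ-< x l-x<e))))))
    where
    cancel : ∀ w → (w + e) - e ≈ w
    cancel w = trans (+-assoc w e (- e)) (trans (+-congˡ (-‿inverseʳ e)) (+-identityʳ w))

    l-x<e : - (x - l) < e
    l-x<e with <-cotrans close (- (x - l))
    ... | inj₁ ∣∣< with () ← -x≤∣x∣ (x - l) ∣∣<
    ... | inj₂ <e = <e

    shift : - (x - l) + x ≈ l
    shift = trans (+-congʳ (trans (sym (-‿+-comm x (- l)))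
                                  (trans (+-comm _ _) (+-congʳ (-‿involutive l)))))
      (trans (+-assoc l (- x) x) (trans (+-congˡ (-‿inverseˡ x)) (+-identityʳ l)))
      where open RingProperties ring using (-‿+-comm; -‿involutive)

  Exp2⇒¼≤ : ∀ y → Exp y (ι 2) → ½ * ½ ≤ y
  Exp2⇒¼≤ y expy y<¼ =
    approx-≤ (suc n) (⁻¹-inverse (ι (suc n)) (0<ι (suc n)))
      (0<⁻¹ (ι (suc n)) (0<ι (suc n)))
      (<-≤-trans (archimedean (- y) .proj₂)
        (ι-mono (ℕₚ.≤-trans (ℕₚ.m≤n+m M N) (ℕₚ.n≤1+n n))))
      (<⇒≤ y<¼)
      (close⇒< (expApprox y n) 1½+½≈2 (expy ½ 0<½ .proj₂ n (ℕₚ.m≤m+n N M)))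
    where
    N = expy ½ 0<½ .proj₁
    M = archimedean (- y) .proj₁
    n = N ℕ.+ M
    1½+½≈2 : (1# + ½) + ½ ≈ ι 2
    1½+½≈2 = trans (+-assoc 1# ½ ½) (+-congˡ (trans ½+½≈1 (sym (+-identityʳ 1#))))

  0<log2 : 0# < log (ι 2) (0<ι 2)
  0<log2 = <-≤-trans (0<* 0<½ 0<½) (Exp2⇒¼≤ _ (exp-log (ι 2) (0<ι 2)))

------------------------------------------------------------------------
-- Computing OR from noisy queries

OR : ∀ {K} → Vec Bool K → Bool
OR = Vec.foldr′ _∨_ false

module NoisyOR {c ℓ} (ℝ : Reals c ℓ) where
  open Reals ℝ public
  open Log2 ℝ using (0<log2)

  -- Sums over Bool and over A ⁿ, and the maximum over {0,1}ᴷ.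

  ∑ᵇ : (Bool → Carrier) → Carrier
  ∑ᵇ f = f false + f true

  ∑ᵛ : ∀ {a} {A : Set a} → ((A → Carrier) → Carrier) →
       ∀ n → (Vec A n → Carrier) → Carrier
  ∑ᵛ ∑ᴬ zero    f = f []
  ∑ᵛ ∑ᴬ (suc n) f = ∑ᴬ λ x → ∑ᵛ ∑ᴬ n λ xs → f (x ∷ xs)

  maxᵛ : ∀ K → (Vec Bool K → Carrier) → Carrier
  maxᵛ zero    f = f []
  maxᵛ (suc K) f = maxᵛ K (λ θ → f (false ∷ θ)) ⊔ʳ maxᵛ K (λ θ → f (true ∷ θ))

  record Distribution {A : Set} (∑ : (A → Carrier) → Carrier) : Set (c ⊔ ℓ) where
    field
      prob   : A → Carrier
      nonneg : ∀ x → 0# ≤ prob x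
      total  : ∑ prob ≈ 1#

  open Distribution public

  -- The queried indices together with the observations.
  History : ℕ → ℕ → Set
  History K T = Vec (Fin K × Bool) T

  ∑ʰ : ∀ K T → (History K T → Carrier) → Carrier
  ∑ʰ K = ∑ᵛ λ f → sum λ k → ∑ᵇ λ y → f (k , y)

  record NonAdaptive (K T : ℕ) : Set (c ⊔ ℓ) where
    field
      sampling : Fin T → Distribution (sum {K})
      output   : History K T → Distribution ∑ᵇ

  open NonAdaptive public

  -- The probability that the binary symmetric channel maps x to y.
  bsc : Carrier → Bool → Bool → Carrier
  bsc p x y = if x xor y then p else 1# - p

  historyProb : ∀ {K T} → Carrier → NonAdaptive K T → Vec Bool K → History K T → Carrier
  historyProb p alg θ h = product λ t →
    let (k , y) = lookup h t in prob (sampling alg t) k * bsc p (lookup θ k) y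

  errorProb : ∀ {K T} → Carrier → NonAdaptive K T → Vec Bool K → Carrier
  errorProb {K} {T} p alg θ = ∑ʰ K T λ h → ∑ᵇ λ o →
    if o xor OR θ then historyProb p alg θ h * prob (output alg h) o else 0#

  worstCaseError : ∀ {K T} → Carrier → NonAdaptive K T → Carrier
  worstCaseError {K} p alg = maxᵛ K (errorProb p alg)

  -- b ≤ inf f, without first constructing the infimum.
  infix 4 _≤inf_
  _≤inf_ : ∀ {i} {I : Set i} → Carrier → (I → Carrier) → Set (i ⊔ ℓ)
  b ≤inf f = ∀ i → b ≤ f i

  -- Quantities depending on p ∈ (0, 1/2)

  module _ (p : Carrier) (0<p : 0# < p) (p<½ : p < ½) where

    0<1-p : 0# < 1# - p
    0<1-p = <⇒0<- (<-trans p<½ ½<1)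

    minimaxBound : (K T : ℕ) .{{_ : NonZero K}} → Carrier
    minimaxBound K T = ½ * (1# - √ (1# / (ι 2 * ι K) [ 0<* (0<ι 2) (0<ι K) ]
      * ((1# + (1# - ι 2 * p) ^ 2
                 / (ι K * (1# - p) * p) [ 0<* (0<* (0<ι K) 0<1-p) 0<p ]) ^ T - 1#)))

    log₂ : ∀ x → 0# < x → Carrier
    log₂ x 0<x = log x 0<x / log (ι 2) (0<ι 2) [ 0<log2 ]

    H : Carrier
    H = - (p * log₂ p 0<p) - (1# - p) * log₂ (1# - p) 0<1-p

    -- The division is legitimate because H(p) < 1 for p ≠ 1/2.
    complexityBound : (K : ℕ) .{{_ : NonZero K}} → 0# < 1# - H → Carrier
    complexityBound K 0<1-H =
      ι K ⊔ʳ (ι K * log (ι K) (0<ι K) * p) / (1# - H) [ 0<1-H ]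

{-# OPTIONS --safe #-}
module Submission where

-- Let e = 1 - 2p and A = e² / (p (1 - p)).  Test θ = 0 against a mixture, with
-- weights w_j, of the sequences whose only 1 is at j.  The likelihood ratios of
-- the latter are uncorrelated under θ = 0, and have variance
-- d_j = ∏_t (1 + A p_t(j)) - 1.  By Cauchy-Schwarz the optimal test therefore
-- satisfies 4 (1 - 2 error)² ≤ Σ w_j² d_j.  Uniform weights are not enough when
-- the p_t are far from uniform; with w_j proportional to 1 / d_j the right-hand
-- side is 1 / Σ (1 / d_j), and convexity of x ↦ 1 / (xᵀ - 1) together with AM-GM
-- bounds it by ((1 + A/K)ᵀ - 1) / K.
--
-- For the query complexity, error < 0.49 makes (1 + A/K)ᵀ - 1 at least K / 625, so
-- (1 + A/K)⁶²⁵ᵀ > K and 625 T A/K ≥ log K, while 1 - H(p) ≥ e² / 8.  This bound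
-- degenerates as p → 0; T ≥ K / 50 follows instead from the fact that the
-- histories that do not query j carry no information about θ_j.

open import Defs
open import Level using (_⊔_)
open import Algebra.Bundles using (CommutativeRing)
import Algebra.Properties.CommutativeMonoid.Sum as CommutativeMonoidSum
import Algebra.Properties.CommutativeSemiring.Exp as CommutativeSemiringExp
import Algebra.Properties.Ring as RingProperties
import Algebra.Properties.Semiring.Exp as SemiringExp
import Algebra.Properties.Semiring.Mult as SemiringMult
import Algebra.Properties.Semiring.Mult.TCOptimised as Multiples
import Algebra.Properties.Semiring.Sum as SemiringSum
import Algebra.Solver.Ring as RingSolver
open import Algebra.Solver.Ring.AlmostCommutativeRing
  using (fromCommutativeRing; _-Raw-AlmostCommutative⟶_)
open import Data.Bool.Base using (Bool; true; false; if_then_else_; not; _∨_; _xor_)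
open import Data.Bool.Properties using (∨-zeroʳ)
open import Data.Fin.Base using (Fin; zero; suc)
import Data.Fin.Properties as Finₚ
open import Data.Integer.Base as ℤ using (ℤ; +_; -[1+_])
import Data.Integer.Properties as ℤₚ
open import Data.Maybe.Base using (Maybe; just; nothing)
open import Data.Nat.Base as ℕ using (ℕ; zero; suc; NonZero)
import Data.Nat.Properties as ℕₚ
open import Data.Product.Base using (Σ-syntax; ∃-syntax; _×_; _,_; proj₁; proj₂)
open import Data.Sum.Base using (inj₁; inj₂)
open import Data.Unit.Base using (tt)
open import Data.Vec.Base as Vec using (Vec; []; _∷_; lookup; tabulate)
open import Data.Vec.Properties using (lookup∘tabulate; lookup-replicate)
open import Function.Base using (_∘_)
open import Relation.Binary.PropositionalEquality.Core as ≡ using (_≡_; _≢_)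
open import Relation.Nullary using (does; yes; no)
open import Relation.Nullary.Decidable using (dec-true; dec-false)

-- Ring solver with integer coefficients

module IntegerCoefficients {c ℓ} (R : CommutativeRing c ℓ) where
  open CommutativeRing R
  open RingProperties ring using (-0#≈0#; -‿+-comm; -‿involutive; -‿distribˡ-*; -‿distribʳ-*)
  open Multiples semiring using (×-homo-+; ×1-homo-*; 1+×) renaming (_×_ to _·_)
  open import Relation.Binary.Reasoning.Setoid setoid

  -- These multiples are the optimised ones, for which `0 · 1#` and `1 · 1#` reduce to `0#` and
  -- `1#`. The solver's constants `:0` and `:1` therefore denote `0#` and `1#` by definition.
  fromℤ : ℤ → Carrier
  fromℤ (+ n)    = n · 1#
  fromℤ -[1+ n ] = - (suc n · 1#)

  fromℤ-⊖ : ∀ m n → fromℤ (m ℤ.⊖ n) ≈ m · 1# - n · 1#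
  fromℤ-⊖ m       zero    = sym (trans (+-congˡ -0#≈0#) (+-identityʳ _))
  fromℤ-⊖ zero    (suc n) = sym (+-identityˡ _)
  fromℤ-⊖ (suc m) (suc n) = begin
    fromℤ (suc m ℤ.⊖ suc n)                ≡⟨ ≡.cong fromℤ (ℤₚ.[1+m]⊖[1+n]≡m⊖n m n) ⟩
    fromℤ (m ℤ.⊖ n)                        ≈⟨ fromℤ-⊖ m n ⟩
    m · 1# - n · 1#                        ≈⟨ +-congʳ (+-identityʳ _) ⟨
    (m · 1# + 0#) - n · 1#                 ≈⟨ +-congʳ (+-congˡ (-‿inverseʳ 1#)) ⟨
    (m · 1# + (1# - 1#)) - n · 1#          ≈⟨ +-congʳ (trans (+-congʳ (+-comm _ _)) (+-assoc _ _ _)) ⟨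
    ((1# + m · 1#) - 1#) - n · 1#          ≈⟨ trans (+-congˡ (sym (-‿+-comm _ _))) (sym (+-assoc _ _ _)) ⟨
    (1# + m · 1#) - (1# + n · 1#)          ≈⟨ +-cong (1+× m 1#) (-‿cong (1+× n 1#)) ⟨
    suc m · 1# - suc n · 1#                ∎

  fromℤ-+ : ∀ i j → fromℤ (i ℤ.+ j) ≈ fromℤ i + fromℤ j
  fromℤ-+ (+ m)    (+ n)    = ×-homo-+ 1# m n
  fromℤ-+ (+ m)    -[1+ n ] = fromℤ-⊖ m (suc n)
  fromℤ-+ -[1+ m ] (+ n)    = trans (fromℤ-⊖ n (suc m)) (+-comm _ _)
  fromℤ-+ -[1+ m ] -[1+ n ] = begin
    - (suc (suc (m ℕ.+ n)) · 1#)       ≡⟨ ≡.cong (λ k → - (suc k · 1#)) (ℕₚ.+-suc m n) ⟨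
    - ((suc m ℕ.+ suc n) · 1#)         ≈⟨ -‿cong (×-homo-+ 1# (suc m) (suc n)) ⟩
    - (suc m · 1# + suc n · 1#)        ≈⟨ -‿+-comm _ _ ⟨
    - (suc m · 1#) - suc n · 1#        ∎

  fromℤ-neg : ∀ i → fromℤ (ℤ.- i) ≈ - fromℤ i
  fromℤ-neg (+ zero)  = sym -0#≈0#
  fromℤ-neg (+ suc n) = refl
  fromℤ-neg -[1+ n ]  = sym (-‿involutive _)

  fromℤ-* : ∀ i j → fromℤ (i ℤ.* j) ≈ fromℤ i * fromℤ j
  fromℤ-* (+ m) (+ n) = trans (reflexive (≡.cong fromℤ (≡.sym (ℤₚ.pos-* m n)))) (×1-homo-* m n)
  fromℤ-* (+ m) -[1+ n ] = begin
    fromℤ ((+ m) ℤ.* -[1+ n ])      ≡⟨ ≡.cong fromℤ (ℤₚ.neg-distribʳ-* (+ m) (+ suc n)) ⟨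
    fromℤ (ℤ.- (+ m ℤ.* + suc n))   ≈⟨ fromℤ-neg (+ m ℤ.* + suc n) ⟩
    - fromℤ (+ m ℤ.* + suc n)       ≈⟨ -‿cong (fromℤ-* (+ m) (+ suc n)) ⟩
    - (m · 1# * suc n · 1#)         ≈⟨ -‿distribʳ-* _ _ ⟩
    m · 1# * - (suc n · 1#)         ∎
  fromℤ-* -[1+ m ] (+ n) = begin
    fromℤ (-[1+ m ] ℤ.* + n)        ≡⟨ ≡.cong fromℤ (ℤₚ.neg-distribˡ-* (+ suc m) (+ n)) ⟨
    fromℤ (ℤ.- (+ suc m ℤ.* + n))   ≈⟨ fromℤ-neg (+ suc m ℤ.* + n) ⟩
    - fromℤ (+ suc m ℤ.* + n)       ≈⟨ -‿cong (fromℤ-* (+ suc m) (+ n)) ⟩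
    - (suc m · 1# * n · 1#)         ≈⟨ -‿distribˡ-* _ _ ⟩
    - (suc m · 1#) * n · 1#         ∎
  fromℤ-* -[1+ m ] -[1+ n ] = begin
    (suc m ℕ.* suc n) · 1#               ≈⟨ ×1-homo-* (suc m) (suc n) ⟩
    suc m · 1# * suc n · 1#              ≈⟨ -‿involutive _ ⟨
    - (- (suc m · 1# * suc n · 1#))      ≈⟨ -‿cong (-‿distribˡ-* _ _) ⟩
    - (- (suc m · 1#) * suc n · 1#)      ≈⟨ -‿distribʳ-* _ _ ⟩
    - (suc m · 1#) * - (suc n · 1#)      ∎

  homomorphism : ℤ.+-*-rawRing -Raw-AlmostCommutative⟶ fromCommutativeRing R
  homomorphism = record
    { ⟦_⟧ = fromℤ ; +-homo = fromℤ-+ ; *-homo = fromℤ-* ; -‿homo = fromℤ-neg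
    ; 0-homo = refl ; 1-homo = refl }

  fromℤ-≟ : ∀ i j → Maybe (fromℤ i ≈ fromℤ j)
  fromℤ-≟ i j with i ℤₚ.≟ j
  ... | yes i≡j = just (reflexive (≡.cong fromℤ i≡j))
  ... | no  _   = nothing

  open RingSolver _ _ homomorphism fromℤ-≟ public
    using (solve; _:=_; con; _:+_; _:*_; _:-_; :-_; _:×_; Polynomial)

  :0 :1 : ∀ {n} → Polynomial n
  :0 = con (+ 0)
  :1 = con (+ 1)

-- Ordered fields

module OrderProperties {c ℓ} (ℝ : Reals c ℓ) where
  open Reals ℝ hiding (zero)
  open Log2 ℝ
  open IntegerCoefficients commutativeRing

  -- The order is not decidable, but `x ≤ y` is a negation, so its proof may compare any two
  -- elements: each case is refuted in turn.
  ≤-cases : ∀ a b {x y} → (a < b → x ≤ y) → (b ≤ a → x ≤ y) → x ≤ y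
  ≤-cases a b lt ge y<x = ge (λ a<b → lt a<b y<x) y<x

  ≈⇒≤ : ∀ {x y} → x ≈ y → x ≤ y
  ≈⇒≤ x≈y = ≤-respʳ-≈ x≈y ≤-refl

  +-mono-≤ : ∀ {x y u v} → x ≤ y → u ≤ v → x + u ≤ y + v
  +-mono-≤ x≤y u≤v = ≤-trans (+-monoˡ-≤ _ x≤y) (+-monoʳ-≤ _ u≤v)

  0≤+ : ∀ {x y} → 0# ≤ x → 0# ≤ y → 0# ≤ x + y
  0≤+ 0≤x 0≤y = ≤-respˡ-≈ (+-identityʳ 0#) (+-mono-≤ 0≤x 0≤y)

  ≤-by : ∀ {x y d} → 0# ≤ d → x + d ≈ y → x ≤ y
  ≤-by {x} 0≤d x+d≈y =
    ≤-respˡ-≈ (+-identityʳ x) (≤-respʳ-≈ x+d≈y (+-monoʳ-≤ x 0≤d))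

  -- The summand k * (l - r) lets the ring solver use the hypothesis l ≈ r.
  modulo : ∀ {l r} → l ≈ r → ∀ k {x} → x ≈ x + k * (l - r)
  modulo {l} {r} l≈r k {x} = sym (trans (+-congˡ (trans (*-congˡ (trans (+-congʳ l≈r) (-‿inverseʳ r)))
    (zeroʳ k))) (+-identityʳ x))

  ≤⇒0≤- : ∀ {x y} → x ≤ y → 0# ≤ y - x
  ≤⇒0≤- {x} x≤y = ≤-respˡ-≈ (-‿inverseʳ x) (+-monoˡ-≤ (- x) x≤y)

  0≤-⇒≤ : ∀ {x y} → 0# ≤ y - x → x ≤ y
  0≤-⇒≤ {x} {y} 0≤ = ≤-by 0≤ (solve 2 (λ x y → x :+ (y :- x) := y) refl x y)

  0<-⇒< : ∀ {x y} → 0# < y - x → x < y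
  0<-⇒< {x} {y} 0< = <-respˡ-≈ (+-identityˡ x)
    (<-respʳ-≈ (solve 2 (λ x y → (y :- x) :+ x := y) refl x y) (+-monoˡ-< x 0<))

  ≤-<-trans : ∀ {x y z} → x ≤ y → y < z → x < z
  ≤-<-trans {x} {y} {z} x≤y y<z with <-cotrans y<z x
  ... | inj₂ x<z = x<z
  ... | inj₁ y<x with () ← x≤y y<x

  0<0≤+ : ∀ {x y} → 0# < x → 0# ≤ y → 0# < x + y
  0<0≤+ {x} 0<x 0≤y = <-≤-trans 0<x (≤-respˡ-≈ (+-identityʳ x) (+-monoʳ-≤ x 0≤y))

  0≤* : ∀ {x y} → 0# ≤ x → 0# ≤ y → 0# ≤ x * y
  0≤* {x} {y} 0≤x 0≤y = ≤-cases 0# y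
    (λ 0<y → ≤-respˡ-≈ (zeroˡ y) (*-monoˡ-≤ 0<y 0≤x))
    (λ y≤0 → ≈⇒≤ (sym (trans (*-congˡ (≤-antisym y≤0 0≤y)) (zeroʳ x))))

  *-monoˡ-≤₀ : ∀ {z} → 0# ≤ z → ∀ {x y} → x ≤ y → x * z ≤ y * z
  *-monoˡ-≤₀ {z} 0≤z {x} {y} x≤y = 0≤-⇒≤
    (≤-respʳ-≈ (solve 3 (λ x y z → (y :- x) :* z := y :* z :- x :* z) refl x y z)
      (0≤* (≤⇒0≤- x≤y) 0≤z))

  *-monoʳ-≤₀ : ∀ {z} → 0# ≤ z → ∀ {x y} → x ≤ y → z * x ≤ z * y
  *-monoʳ-≤₀ 0≤z x≤y = ≤-respˡ-≈ (*-comm _ _) (≤-respʳ-≈ (*-comm _ _) (*-monoˡ-≤₀ 0≤z x≤y))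

  *-mono-≤ : ∀ {x y u v} → 0# ≤ x → x ≤ y → 0# ≤ u → u ≤ v → x * u ≤ y * v
  *-mono-≤ 0≤x x≤y 0≤u u≤v =
    ≤-trans (*-monoˡ-≤₀ 0≤u x≤y) (*-monoʳ-≤₀ (≤-trans 0≤x x≤y) u≤v)

  *-cancelʳ-≤ : ∀ {z} → 0# < z → ∀ {x y} → x * z ≤ y * z → x ≤ y
  *-cancelʳ-≤ 0<z xz≤yz y<x = xz≤yz (*-monoˡ-< 0<z y<x)

  x≤0⇒0≤-x : ∀ {x} → x ≤ 0# → 0# ≤ - x
  x≤0⇒0≤-x {x} x≤0 = ≤-respʳ-≈ (+-identityˡ (- x)) (≤⇒0≤- x≤0)

  0≤x² : ∀ x → 0# ≤ x * x
  0≤x² x = ≤-cases 0# x (λ 0<x → <⇒≤ (0<* 0<x 0<x))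
    λ x≤0 → ≤-respʳ-≈ (solve 1 (λ x → :- x :* :- x := x :* x) refl x)
              (0≤* (x≤0⇒0≤-x x≤0) (x≤0⇒0≤-x x≤0))

  0≤1 : 0# ≤ 1#
  0≤1 = <⇒≤ 0<1

  0≤ι : ∀ n → 0# ≤ ι n
  0≤ι n = ι-mono (ℕ.z≤n {n})

  0≤^ : ∀ {x} → 0# ≤ x → ∀ n → 0# ≤ x ^ n
  0≤^ 0≤x zero    = 0≤1
  0≤^ 0≤x (suc n) = 0≤* 0≤x (0≤^ 0≤x n)

  ^-monoˡ-≤ : ∀ {x y} n → 0# ≤ x → x ≤ y → x ^ n ≤ y ^ n
  ^-monoˡ-≤ zero    0≤x x≤y = ≤-refl
  ^-monoˡ-≤ (suc n) 0≤x x≤y = *-mono-≤ 0≤x x≤y (0≤^ 0≤x n) (^-monoˡ-≤ n 0≤x x≤y)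

  1^ : ∀ n → 1# ^ n ≈ 1#
  1^ zero    = refl
  1^ (suc n) = trans (*-identityˡ _) (1^ n)

  -- AM-GM for n copies of one power and one of the other, without roots. The induction rests on an
  -- identity: the difference of the two sides at n + 1 is b times the difference at n plus (n + 1)
  -- aⁿ (b - a)².
  weighted-amgm : ∀ {a b} → 0# ≤ a → 0# ≤ b → ∀ n →
          ι (suc n) * (a ^ n * b) ≤ b ^ suc n + ι n * a ^ suc n
  weighted-amgm {a} {b} 0≤a 0≤b zero = ≈⇒≤ (solve 2 (λ a b →
    (:1 :+ :0) :* (:1 :* b) := b :* :1 :+ :0 :* (a :* :1)) refl a b)
  weighted-amgm {a} {b} 0≤a 0≤b (suc n) = ≤-by
    (0≤+ (0≤* 0≤b (≤⇒0≤- (weighted-amgm 0≤a 0≤b n)))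
         (0≤* (0≤* (0≤ι (suc n)) (0≤^ 0≤a n)) (0≤x² (b - a))))
    (solve 5 (λ a b k A B →
      (:1 :+ (:1 :+ k)) :* ((a :* A) :* b)
      :+ (b :* ((B :+ k :* (a :* A)) :- (:1 :+ k) :* (A :* b))
          :+ ((:1 :+ k) :* A) :* ((b :- a) :* (b :- a)))
      := b :* B :+ (:1 :+ k) :* (a :* (a :* A))) refl a b (ι n) (a ^ n) (b ^ suc n))

  bernoulli : ∀ {x} → 0# ≤ 1# + x → ∀ n → 1# + ι n * x ≤ (1# + x) ^ n
  bernoulli {x} 0≤1+x zero    = ≈⇒≤ (solve 1 (λ x → :1 :+ :0 :* x := :1) refl x)
  bernoulli {x} 0≤1+x (suc n) = ≤-by (≤⇒0≤- (weighted-amgm 0≤1 0≤1+x n))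
    (trans (+-congˡ (+-cong (+-congˡ (trans (*-congˡ (1^ (suc n))) (*-identityʳ _)))
                            (-‿cong (*-congˡ (trans (*-congʳ (1^ n)) (*-identityˡ _))))))
      (solve 3 (λ x k B → (:1 :+ (:1 :+ k) :* x)
          :+ ((B :+ k) :- (:1 :+ k) :* (:1 :+ x)) := B)
        refl x (ι n) ((1# + x) ^ suc n)))

  square-cancel-≤ : ∀ {x y} → 0# ≤ y → x * x ≤ y * y → x ≤ y
  square-cancel-≤ {x} {y} 0≤y x²≤y² y<x = x²≤y²
    (≤-<-trans (*-monoʳ-≤₀ 0≤y (<⇒≤ y<x)) (*-monoˡ-< (≤-<-trans 0≤y y<x) y<x))

-- Mean inequalities

module MeanInequalities {c ℓ} (ℝ : Reals c ℓ) where
  open Reals ℝ hiding (zero)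
  open Log2 ℝ
  open OrderProperties ℝ
  open IntegerCoefficients commutativeRing
  open SemiringSum semiring using (∑-distrib-+)
  module Product = CommutativeMonoidSum *-commutativeMonoid
  open CommutativeSemiringExp commutativeSemiring using (^-distrib-*)
  open SemiringExp semiring using (^-congˡ)

  sum-mono-≤ : ∀ {n} {f g : Fin n → Carrier} → (∀ i → f i ≤ g i) → sum f ≤ sum g
  sum-mono-≤ {zero}  f≤g = ≤-refl
  sum-mono-≤ {suc n} f≤g = +-mono-≤ (f≤g zero) (sum-mono-≤ (f≤g ∘ suc))

  sum-const : ∀ n x → sum {n} (λ _ → x) ≈ ι n * x
  sum-const zero    x = sym (zeroˡ x)
  sum-const (suc n) x = trans (+-cong (sym (*-identityˡ x)) (sum-const n x)) (sym (distribʳ x 1# (ι n)))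

  0≤sum : ∀ {n} {f : Fin n → Carrier} → (∀ i → 0# ≤ f i) → 0# ≤ sum f
  0≤sum {n} 0≤f = ≤-respˡ-≈ (trans (sum-const n 0#) (zeroʳ _)) (sum-mono-≤ 0≤f)

  product-mono-≤ : ∀ {n} {f g : Fin n → Carrier} → (∀ i → 0# ≤ f i) → (∀ i → f i ≤ g i) →
                   product f ≤ product g
  0≤product : ∀ {n} {f : Fin n → Carrier} → (∀ i → 0# ≤ f i) → 0# ≤ product f

  0≤product {zero}  0≤f = 0≤1
  0≤product {suc n} 0≤f = 0≤* (0≤f zero) (0≤product (0≤f ∘ suc))

  product-mono-≤ {zero}  0≤f f≤g = ≤-refl
  product-mono-≤ {suc n} 0≤f f≤g =
    *-mono-≤ (0≤f zero) (f≤g zero) (0≤product (0≤f ∘ suc)) (product-mono-≤ (0≤f ∘ suc) (f≤g ∘ suc))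

  product-const : ∀ n x → product {n} (λ _ → x) ≈ x ^ n
  product-const zero    x = refl
  product-const (suc n) x = *-congˡ (product-const n x)

  mean : ∀ {n} (x : Fin n → Carrier) → (∀ i → 0# ≤ x i) → ∃[ m ] (0# ≤ m × sum x ≈ ι n * m)
  mean {zero}  x 0≤x = 0# , ≤-refl , sym (zeroˡ 0#)
  mean {suc n} x 0≤x = sum x / ι (suc n) [ 0<ι (suc n) ] ,
    0≤* (0≤sum 0≤x) (<⇒≤ (0<⁻¹ _ _)) ,
    sym (trans (solve 3 (λ a s i → a :* (s :* i) := s :* (a :* i)) refl _ _ _)
      (trans (*-congˡ (⁻¹-inverse _ _)) (*-identityʳ _)))

  -- If a is the mean of the tail, the tail contributes at most aⁿ by induction. Since (n + 1) m is
  -- the head plus n a, `weighted-amgm` for a and m bounds head times aⁿ by m to the power n + 1.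
  amgm : ∀ {n} (x : Fin n → Carrier) → (∀ i → 0# ≤ x i) →
         ∀ {m} → 0# ≤ m → sum x ≈ ι n * m → product x ≤ m ^ n
  amgm {zero}  x 0≤x 0≤m x̄≈m = ≤-refl
  amgm {suc n} x 0≤x {m} 0≤m x̄≈m with mean (x ∘ suc) (0≤x ∘ suc)
  ... | a , 0≤a , x̄≈a = ≤-trans (*-monoʳ-≤₀ (0≤x zero) (amgm (x ∘ suc) (0≤x ∘ suc) 0≤a x̄≈a))
    (≤-by (≤⇒0≤- (weighted-amgm 0≤a 0≤m n))
      (trans (+-congˡ (+-congˡ (-‿cong (trans split (*-congʳ (trans (sym x̄≈m) (+-congˡ x̄≈a)))))))
        (solve 5 (λ y A M k a → y :* A :+ ((M :+ k :* (a :* A)) :- (y :+ k :* a) :* A) := M)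
          refl (x zero) (a ^ n) (m ^ suc n) (ι n) a)))
    where
    split : ι (suc n) * (a ^ n * m) ≈ ι (suc n) * m * a ^ n
    split = solve 3 (λ k A m → k :* (A :* m) := k :* m :* A) refl (ι (suc n)) (a ^ n) m

  -- Both factors have the same sign. The induction avoids asking which: x (x - 1) (xⁿ - 1) plus a
  -- square gives the next product.
  0≤[x-1][xⁿ-1] : ∀ {x} → 0# ≤ x → ∀ n → 0# ≤ (x - 1#) * (x ^ n - 1#)
  0≤[x-1][xⁿ-1] {x} 0≤x zero =
    ≈⇒≤ (solve 1 (λ x → :0 := (x :- :1) :* (:1 :- :1)) refl x)
  0≤[x-1][xⁿ-1] {x} 0≤x (suc n) = ≤-respʳ-≈
    (solve 2 (λ x X → x :* ((x :- :1) :* (X :- :1)) :+ (x :- :1) :* (x :- :1)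
                      := (x :- :1) :* (x :* X :- :1)) refl x (x ^ n))
    (0≤+ (0≤* 0≤x (0≤[x-1][xⁿ-1] 0≤x n)) (0≤x² (x - 1#)))

  -- Tangent at x = 1 of the convex function x ↦ 1 / ((1 + D) xⁿ - 1), with denominators cleared.
  tangent : ∀ {x D} → 0# ≤ x → 0# ≤ D → ∀ n →
            (x ^ n - 1#) * D ≤ ι n * (x - 1#) * ((1# + D) * x ^ n - 1#)
  tangent {x} {D} 0≤x 0≤D n = ≤-by
    (0≤+ (0≤* 0≤D (≤⇒0≤- (weighted-amgm 0≤x 0≤1 n))) (0≤* (0≤ι n) (0≤[x-1][xⁿ-1] 0≤x n)))
    (trans (+-congˡ (+-congʳ (*-congˡ (+-congʳ (+-congʳ (1^ (suc n)))))))
      (solve 4 (λ x D k X → (X :- :1) :* D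
          :+ (D :* ((:1 :+ k :* (x :* X)) :- (:1 :+ k) :* (X :* :1))
              :+ k :* ((x :- :1) :* (X :- :1)))
        := k :* (x :- :1) :* ((:1 :+ D) :* X :- :1))
        refl x D (ι n) (x ^ n)))

  -- The quotient (w - 1) / ((1 + D) w - 1) is nondecreasing where its denominator is positive, so a
  -- tangent bound proved for a power w passes to a product v that AM-GM puts below it.
  tangent-≤ : ∀ {v w D Y} → 0# ≤ D → (w - 1#) * D ≤ Y * ((1# + D) * w - 1#) →
              v ≤ w → 0# < (1# + D) * v - 1# → (v - 1#) * D ≤ Y * ((1# + D) * v - 1#)
  tangent-≤ {v} {w} {D} {Y} 0≤D tan v≤w 0<Cv-1 = *-cancelʳ-≤
    (<-≤-trans 0<Cv-1 (+-monoˡ-≤ _ (*-monoʳ-≤₀ (0≤+ 0≤1 0≤D) v≤w)))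
    (≤-by (0≤+ (0≤* (<⇒≤ 0<Cv-1) (≤⇒0≤- tan)) (0≤* (0≤* 0≤D 0≤D) (≤⇒0≤- v≤w)))
      (solve 4 (λ v w D Y → (v :- :1) :* D :* ((:1 :+ D) :* w :- :1)
          :+ (((:1 :+ D) :* v :- :1) :* (Y :* ((:1 :+ D) :* w :- :1) :- (w :- :1) :* D)
              :+ D :* D :* (w :- v))
        := Y :* ((:1 :+ D) :* v :- :1) :* ((:1 :+ D) :* w :- :1))
        refl v w D Y))

  -- The same tangent for 1 / (∏ xᵢ - 1) at xᵢ = s, where sⁿ = 1 + D, σ = 1 / s and u = 1 / d.
  product-tangent : ∀ {n} (x : Fin n → Carrier) → (∀ i → 0# ≤ x i) →
    ∀ {s σ D d u} → 0# ≤ σ → s * σ ≈ 1# → s ^ n ≈ 1# + D → 0# ≤ D →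
    product x ≈ 1# + d → 0# < d → 0# ≤ u → d * u ≈ 1# →
    D ≤ D * D * u + (1# + D) * sum (λ i → x i * σ - 1#)
  product-tangent {n} x 0≤x {s} {σ} {D} {d} {u} 0≤σ sσ≈1 sⁿ≈C 0≤D ∏x≈1+d 0<d 0≤u du≈1
    with mean (λ i → x i * σ) (λ i → 0≤* (0≤x i) 0≤σ)
  ... | m , 0≤m , mean≈m = ≤-by (0≤* 0≤u (≤⇒0≤- (*-monoʳ-≤₀ (0≤+ 0≤1 0≤D) tan)))
      (trans (modulo Cv≈ (- (u * ((1# + D) * Y - D))))
      (trans (modulo du≈1 (- ((1# + D) * Y - D)))
        (solve 5 (λ u d D Y v →
          D :+ u :* ((:1 :+ D) :* (Y :* ((:1 :+ D) :* v :- :1))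
                     :- (:1 :+ D) :* ((v :- :1) :* D))
            :+ :- (u :* ((:1 :+ D) :* Y :- D)) :* ((:1 :+ D) :* v :- (:1 :+ d))
            :+ :- ((:1 :+ D) :* Y :- D) :* (d :* u :- :1)
          := D :* D :* u :+ (:1 :+ D) :* Y) refl u d D Y v)))
    where
    v = product (λ i → x i * σ)
    Y = sum (λ i → x i * σ - 1#)

    Y≈ : ι n * (m - 1#) ≈ Y
    Y≈ = trans (solve 2 (λ k m → k :* (m :- :1) := k :* m :+ k :* :- :1) refl (ι n) m)
      (trans (+-cong (sym mean≈m) (sym (sum-const n (- 1#))))
        (sym (∑-distrib-+ (λ i → x i * σ) (λ _ → - 1#))))

    Cv≈ : (1# + D) * v ≈ 1# + d
    Cv≈ = trans (*-cong (sym sⁿ≈C) (Product.∑-distrib-+ x (λ _ → σ)))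
      (trans (*-congˡ (*-congˡ (product-const n σ)))
      (trans (solve 3 (λ a b c → a :* (b :* c) := b :* (a :* c)) refl _ _ _)
      (trans (*-congˡ (trans (sym (^-distrib-* s σ n)) (trans (^-congˡ n sσ≈1) (1^ n))))
      (trans (*-identityʳ _) ∏x≈1+d))))

    Cv-1≈d : (1# + D) * v - 1# ≈ d
    Cv-1≈d = trans (+-congʳ Cv≈) (solve 1 (λ d → :1 :+ d :- :1 := d) refl d)

    -- Division by s moves the point of tangency to 1. The tangent is taken at the mean m of the
    -- normalised factors, and AM-GM passes from mⁿ to their product `v`.
    tan : (v - 1#) * D ≤ Y * ((1# + D) * v - 1#)
    tan = tangent-≤ 0≤D (≤-respʳ-≈ (*-congʳ Y≈) (tangent 0≤m 0≤D n))
      (amgm (λ i → x i * σ) (λ i → 0≤* (0≤x i) 0≤σ) 0≤m mean≈m)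
      (<-respʳ-≈ (sym Cv-1≈d) 0<d)

  -- Iterates `≤-cases`: when proving an inequality, either all of finitely many elements are
  -- positive or some one of them is not.
  ≤-cases-∀ : ∀ {n} (f : Fin n → Carrier) {x y} → ((∀ j → 0# < f j) → x ≤ y) →
              (∀ j → f j ≤ 0# → x ≤ y) → x ≤ y
  ≤-cases-∀ {zero}  f all some = all λ ()
  ≤-cases-∀ {suc n} f all some = ≤-cases 0# (f zero)
    (λ 0<f₀ → ≤-cases-∀ (f ∘ suc) (λ 0<f → all λ { zero → 0<f₀ ; (suc j) → 0<f j }) (some ∘ suc))
    (some zero)

  0<sum : ∀ {n} .{{_ : NonZero n}} {f : Fin n → Carrier} → (∀ i → 0# < f i) → 0# < sum f
  0<sum {suc n} 0<f = 0<0≤+ (0<f zero) (0≤sum {n} λ i → <⇒≤ (0<f (suc i)))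

  -- An empty product is 1, so a product above 1 has a factor.
  0<product-1⇒0<ι : ∀ n (f : Fin n → Carrier) → 0# < product f - 1# → 0# < ι n
  0<product-1⇒0<ι zero    f 0<1-1 with () ← <-irrefl (sym (-‿inverseʳ 1#)) 0<1-1
  0<product-1⇒0<ι (suc n) f _     = 0<ι (suc n)

  element≤sum : ∀ {n} (f : Fin n → Carrier) → (∀ i → 0# ≤ f i) → ∀ j → f j ≤ sum f
  element≤sum {suc n} f 0≤f zero    = ≤-by (0≤sum {n} (0≤f ∘ suc)) refl
  element≤sum {suc n} f 0≤f (suc j) = ≤-trans (element≤sum {n} (f ∘ suc) (0≤f ∘ suc) j)
    (≤-by (0≤f zero) (+-comm _ _))

  weierstrass : ∀ {n} (a : Fin n → Carrier) → (∀ i → 0# ≤ a i) → (∀ i → a i ≤ 1#) →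
                1# - sum a ≤ product λ i → 1# - a i
  weierstrass {zero}  a 0≤a a≤1 = ≈⇒≤ (solve 0 (:1 :- :0 := :1) refl)
  weierstrass {suc n} a 0≤a a≤1 = ≤-trans
    (≤-by (0≤* (0≤a zero) (0≤sum {n} (0≤a ∘ suc)))
      (solve 2 (λ a s → :1 :- (a :+ s) :+ a :* s := (:1 :- a) :* (:1 :- s)) refl (a zero) (sum {n} (a ∘ suc))))
    (*-monoʳ-≤₀ (≤⇒0≤- (a≤1 zero)) (weierstrass {n} (a ∘ suc) (0≤a ∘ suc) (a≤1 ∘ suc)))

-- The logarithm

module Logarithms {c ℓ} (ℝ : Reals c ℓ) where
  open Reals ℝ hiding (zero)
  open Log2 ℝ
  open OrderProperties ℝ
  open IntegerCoefficients commutativeRing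
  open CommutativeSemiringExp commutativeSemiring using (^-distrib-*)

  x≤∣x∣ : ∀ x → x ≤ ∣ x ∣
  x≤∣x∣ x = proj₁ (⊔ʳ-supremum x (- x))

  limit-≥ : ∀ {s l b} → s ⟶ l → (∃[ N ] ∀ n → N ℕ.≤ n → b ≤ s n) → b ≤ l
  limit-≥ {s} {l} {b} s⟶l (N , b≤s) l<b with s⟶l (b - l) (<⇒0<- l<b)
  ... | M , close = b≤s n (ℕₚ.m≤m+n N M) (0<-⇒<
      (<-respʳ-≈ (solve 3 (λ b l x → (b :- l) :- (x :- l) := b :- x) refl b l (s n))
        (<⇒0<- (≤-<-trans (x≤∣x∣ (s n - l)) (close n (ℕₚ.m≤n+m M N))))))
    where n = N ℕ.+ M

  limit-≤ : ∀ {s l b} → s ⟶ l → (∃[ N ] ∀ n → N ℕ.≤ n → s n ≤ b) → l ≤ b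
  limit-≤ {s} {l} {b} s⟶l (N , s≤b) b<l with s⟶l (l - b) (<⇒0<- b<l)
  ... | M , close = s≤b n (ℕₚ.m≤m+n N M)
      (close⇒< (s n) (solve 2 (λ b l → b :+ (l :- b) := l) refl b l) (close n (ℕₚ.m≤n+m M N)))
    where n = N ℕ.+ M

  limit-*-≤ : ∀ {s l b} k → 0# < k → s ⟶ l → (∃[ N ] ∀ n → N ℕ.≤ n → s n * k ≤ b) → l * k ≤ b
  limit-*-≤ {s} {l} {b} k 0<k s⟶l (N , sk≤b) =
    ≤-respʳ-≈ (cancel b) (*-monoˡ-≤ 0<k (limit-≤ s⟶l (N , λ n N≤n →
      *-cancelʳ-≤ 0<k (≤-respʳ-≈ (sym (cancel b)) (sk≤b n N≤n)))))
    where
    cancel : ∀ x → x / k [ 0<k ] * k ≈ x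
    cancel x = trans (*-assoc _ _ _) (trans (*-congˡ (trans (*-comm _ _) (⁻¹-inverse k 0<k))) (*-identityʳ x))

  base : Carrier → ℕ → Carrier
  base y n = 1# + y / ι (suc n) [ 0<ι (suc n) ]

  base-scaled : ∀ y n → base y n * ι (suc n) ≈ ι (suc n) + y
  base-scaled y n = trans (modulo (⁻¹-inverse (ι (suc n)) (0<ι (suc n))) (- y))
    (solve 3 (λ y i k → (:1 :+ y :* i) :* k :+ :- y :* (k :* i :- :1) := k :+ y)
      refl y _ (ι (suc n)))

  0≤base : ∀ {y} n → 0# ≤ ι (suc n) + y → 0# ≤ base y n
  0≤base {y} n 0≤ = *-cancelʳ-≤ (0<ι (suc n))
    (≤-respˡ-≈ (sym (zeroˡ _)) (≤-respʳ-≈ (sym (base-scaled y n)) 0≤))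

  0<base : ∀ {y} n → 0# < ι (suc n) + y → 0# < base y n
  0<base {y} n 0< = *-cancelʳ-< (0<ι (suc n))
    (<-respˡ-≈ (sym (zeroˡ _)) (<-respʳ-≈ (sym (base-scaled y n)) 0<))

  0≤ι+ : ∀ {y} m n → m ℕ.≤ n → 0# ≤ ι (suc m) + y → 0# ≤ ι (suc n) + y
  0≤ι+ m n m≤n 0≤ = ≤-trans 0≤ (+-monoˡ-≤ _ (ι-mono (ℕ.s≤s m≤n)))

  -- For the consecutive bases a and b, (n + 2) b - (n + 1) a = 1. With this, `weighted-amgm`
  -- collapses to the comparison of the two powers.
  expApprox-step : ∀ {y} n → 0# ≤ ι (suc n) + y → expApprox y n ≤ expApprox y (suc n)
  expApprox-step {y} n 0≤ = ≤-by (≤⇒0≤- (weighted-amgm (0≤base n 0≤)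
      (0≤base (suc n) (0≤ι+ n (suc n) (ℕₚ.n≤1+n n) 0≤)) (suc n)))
    (trans (modulo (base-scaled y (suc n)) (a ^ suc n))
    (trans (modulo (base-scaled y n) (- (a ^ suc n)))
      (solve 6 (λ a b A B k y →
         A :+ (B :+ k :* (a :* A) :- (:1 :+ k) :* (A :* b))
           :+ A :* (b :* (:1 :+ k) :- (:1 :+ k :+ y))
           :+ :- A :* (a :* k :- (k :+ y)) := B)
        refl a b (a ^ suc n) (b ^ suc (suc n)) (ι (suc n)) y)))
    where
    a = base y n
    b = base y (suc n)

  expApprox-mono : ∀ {y m n} → m ℕ.≤ n → 0# ≤ ι (suc m) + y → expApprox y m ≤ expApprox y n
  expApprox-mono {y} {m} m≤n 0≤ = go (ℕₚ.≤⇒≤′ m≤n)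
    where
    go : ∀ {n} → m ℕ.≤′ n → expApprox y m ≤ expApprox y n
    go ℕ.≤′-refl = ≤-refl
    go {suc n} (ℕ.≤′-step m≤′n) =
      ≤-trans (go m≤′n) (expApprox-step n (0≤ι+ m n (ℕₚ.≤′⇒≤ m≤′n) 0≤))

  expApprox-≤ : ∀ {y x} n → Exp y x → 0# ≤ ι (suc n) + y → expApprox y n ≤ x
  expApprox-≤ n exp 0≤ = limit-≥ exp (n , λ m n≤m → expApprox-mono n≤m 0≤)

  -- AM-GM for four factors of mean 1, two of them equal. The defect is explicit: a² (1 + (1 + a) (1
  -- - a)) + (1 + a)² (a + b)².
  product-≤1 : ∀ {a b c} → 0# ≤ 1# + a → 0# ≤ 1# + b → 0# ≤ 1# + c → a + a + (b + c) ≈ 0# →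
               (1# + a) * (1# + a) * ((1# + b) * (1# + c)) ≤ 1#
  product-≤1 {a} {b} {c} 0≤1+a 0≤1+b 0≤1+c sum≈0 = ≤-by
    (0≤+ (0≤* (0≤x² a) (0≤+ 0≤1 (0≤* 0≤1+a 0≤1-a))) (0≤* (0≤x² (1# + a)) (0≤x² (a + b))))
    (trans (modulo sum≈0 (- ((1# + a) * (1# + a) * (1# + b))))
      (solve 3 (λ a b c → (:1 :+ a) :* (:1 :+ a) :* ((:1 :+ b) :* (:1 :+ c))
          :+ (a :* a :* (:1 :+ (:1 :+ a) :* (:1 :- a)) :+ (:1 :+ a) :* (:1 :+ a) :* ((a :+ b) :* (a :+ b)))
          :+ :- ((:1 :+ a) :* (:1 :+ a) :* (:1 :+ b)) :* (a :+ a :+ (b :+ c) :- :0) := :1) refl a b c))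
    where
    0≤1-a : 0# ≤ 1# - a
    0≤1-a = *-cancelʳ-≤ (0<+ 0<1 0<1) (≤-respˡ-≈ (sym (zeroˡ _))
      (≤-respʳ-≈ (trans (modulo sum≈0 (- 1#))
         (solve 3 (λ a b c → ((:1 :+ b) :+ (:1 :+ c)) :+ :- :1 :* (a :+ a :+ (b :+ c) :- :0)
            := (:1 :- a) :* (:1 :+ :1)) refl a b c))
        (0≤+ 0≤1+b 0≤1+c)))

  -- Bernoulli gives 1 + z ≤ (1 + z / N)ᴺ, so the left side is at most the N-th power of an instance
  -- of `product-≤1`.
  expApprox-product-≤1 : ∀ {z y₀ y₁} n → z + z + (y₀ + y₁) ≈ 0# →
    0# ≤ 1# + z → 0# ≤ ι (suc n) + y₀ → 0# ≤ ι (suc n) + y₁ →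
    (1# + z) * (1# + z) * (expApprox y₀ n * expApprox y₁ n) ≤ 1#
  expApprox-product-≤1 {z} {y₀} {y₁} n sum≈0 0≤1+z 0≤₀ 0≤₁ =
    ≤-trans (*-monoˡ-≤₀ (0≤* (0≤^ 0≤b₀ N) (0≤^ 0≤b₁ N)) (*-mono-≤ 0≤1+z 1+z≤ 0≤1+z 1+z≤))
      (≤-respˡ-≈ collect (≤-respʳ-≈ (1^ N)
        (^-monoˡ-≤ N (0≤* (0≤* 0≤b 0≤b) (0≤* 0≤b₀ 0≤b₁)) (product-≤1 0≤b 0≤b₀ 0≤b₁ scaled))))
    where
    N = suc n
    b = base z n
    b₀ = base y₀ n
    b₁ = base y₁ n
    i = ι N ⁻¹[ 0<ι N ]

    0≤b₀ : 0# ≤ b₀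
    0≤b₀ = 0≤base n 0≤₀
    0≤b₁ : 0# ≤ b₁
    0≤b₁ = 0≤base n 0≤₁
    0≤b : 0# ≤ b
    0≤b = 0≤base n (0≤ι+ 0 n ℕ.z≤n (≤-respʳ-≈ (+-congʳ (sym (+-identityʳ 1#))) 0≤1+z))

    1+z≤ : 1# + z ≤ b ^ N
    1+z≤ = ≤-respˡ-≈ (+-congˡ (trans (modulo (⁻¹-inverse (ι N) (0<ι N)) (- z))
        (solve 3 (λ k z i → k :* (z :* i) :+ :- z :* (k :* i :- :1) := z) refl (ι N) z i)))
      (bernoulli 0≤b N)

    scaled : z * i + z * i + (y₀ * i + y₁ * i) ≈ 0#
    scaled = trans (solve 4 (λ z a b i → z :* i :+ z :* i :+ (a :* i :+ b :* i) := (z :+ z :+ (a :+ b)) :* i)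
      refl z y₀ y₁ i) (trans (*-congʳ sum≈0) (zeroˡ i))

    collect : (b * b * (b₀ * b₁)) ^ N ≈ b ^ N * b ^ N * (b₀ ^ N * b₁ ^ N)
    collect = trans (^-distrib-* (b * b) (b₀ * b₁) N) (*-cong (^-distrib-* b b N) (^-distrib-* b₀ b₁ N))

  eventually-0< : ∀ y → ∃[ N ] ∀ n → N ℕ.≤ n → 0# < ι (suc n) + y
  eventually-0< y with archimedean (- y)
  ... | N , -y<N = N , λ n N≤n → <-respʳ-≈
    (solve 2 (λ k y → k :- :- y := k :+ y) refl (ι (suc n)) y)
    (<⇒0<- (<-≤-trans -y<N (ι-mono (ℕₚ.m≤n⇒m≤1+n N≤n))))

  -- This is the square of 1 + z ≤ exp z, obtained without the addition theorem for exp. The limits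
  -- are taken one factor at a time; for different indices m and n, monotonicity moves both
  -- approximants up to the larger index.
  exp-product-≤1 : ∀ {z y₀ y₁ x₀ x₁} → Exp y₀ x₀ → Exp y₁ x₁ → 0# < x₁ →
    z + z + (y₀ + y₁) ≈ 0# → 0# < 1# + z → (1# + z) * (1# + z) * (x₀ * x₁) ≤ 1#
  exp-product-≤1 {z} {y₀} {y₁} {x₀} {x₁} exp₀ exp₁ 0<x₁ sum≈0 0<1+z
    with eventually-0< y₀ | eventually-0< y₁
  ... | N₀ , 0<₀ | N₁ , 0<₁ = ≤-respˡ-≈
      (solve 3 (λ A x y → x :* (A :* y) := A :* (x :* y)) refl A x₀ x₁)
      (limit-*-≤ (A * x₁) (0<* 0<A 0<x₁) exp₀ (N₀ , λ m N₀≤m →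
        ≤-respˡ-≈ (solve 3 (λ A x y → x :* (A :* y) := y :* (A :* x)) refl A x₁ (E₀ m))
          (limit-*-≤ (A * E₀ m) (0<* 0<A (0<E₀ m N₀≤m)) exp₁ (N₁ , λ n N₁≤n → bound m n N₀≤m N₁≤n))))
    where
    A = (1# + z) * (1# + z)
    0<A : 0# < A
    0<A = 0<* 0<1+z 0<1+z
    E₀ = expApprox y₀
    E₁ = expApprox y₁
    0<E₀ : ∀ m → N₀ ℕ.≤ m → 0# < E₀ m
    0<E₀ m N₀≤m = 0<^ (0<base m (0<₀ m N₀≤m)) (suc m)
    0<E₁ : ∀ m → N₁ ℕ.≤ m → 0# < E₁ m
    0<E₁ m N₁≤m = 0<^ (0<base m (0<₁ m N₁≤m)) (suc m)

    bound : ∀ m n → N₀ ℕ.≤ m → N₁ ℕ.≤ n → E₁ n * (A * E₀ m) ≤ 1#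
    bound m n N₀≤m N₁≤n = ≤-trans
      (≤-respˡ-≈ (solve 3 (λ A x y → A :* (x :* y) := y :* (A :* x)) refl A (E₀ m) (E₁ n))
        (*-monoʳ-≤ 0<A (*-mono-≤ (<⇒≤ (0<E₀ m N₀≤m)) (expApprox-mono (ℕₚ.m≤m⊔n m n) (<⇒≤ (0<₀ m N₀≤m)))
                                 (<⇒≤ (0<E₁ n N₁≤n)) (expApprox-mono (ℕₚ.m≤n⊔m m n) (<⇒≤ (0<₁ n N₁≤n))))))
      (expApprox-product-≤1 k sum≈0 (<⇒≤ 0<1+z)
        (<⇒≤ (0<₀ k (ℕₚ.≤-trans N₀≤m (ℕₚ.m≤m⊔n m n)))) (<⇒≤ (0<₁ k (ℕₚ.≤-trans N₁≤n (ℕₚ.m≤n⊔m m n)))))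
      where k = m ℕ.⊔ n

  -- With a = 1 - (y₀ + y₁) / 2 and x = x₀ x₁ we have a² x ≤ 1; as s σ ≥ 1, also 2 a ≤ a² s + σ.
  log-lower : ∀ {y₀ y₁ x₀ x₁ s σ} → Exp y₀ x₀ → Exp y₁ x₁ → 0# < x₀ → 0# < x₁ →
    0# < s → 0# ≤ σ → 1# ≤ s * σ →
    x₀ * x₁ * (1# + 1# - (y₀ + y₁)) ≤ s + x₀ * x₁ * σ
  log-lower {y₀} {y₁} {x₀} {x₁} {s} {σ} exp₀ exp₁ 0<x₀ 0<x₁ 0<s 0≤σ 1≤sσ =
    ≤-respˡ-≈ (trans (modulo sum≈0 (- x))
      (solve 3 (λ x z y → (x :* ((:1 :+ z) :+ (:1 :+ z))) :+ :- x :* (z :+ z :+ y :- :0)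
         := x :* (:1 :+ :1 :- y)) refl x z (y₀ + y₁)))
    (≤-cases 0# (1# + z)
      (λ 0<a → ≤-trans (*-monoʳ-≤ 0<x (2a≤ 0<a)) (≤-respˡ-≈
         (solve 4 (λ x a s σ → a :* a :* x :* s :+ x :* σ := x :* (a :* a :* s :+ σ)) refl x (1# + z) s σ)
         (+-monoˡ-≤ _ (≤-respʳ-≈ (*-identityˡ s)
           (*-monoˡ-≤ 0<s (exp-product-≤1 exp₀ exp₁ 0<x₁ sum≈0 0<a))))))
      (λ a≤0 → ≤-by (0≤+ (0≤+ (<⇒≤ 0<s) (0≤* (<⇒≤ 0<x) 0≤σ))
          (0≤* (<⇒≤ 0<x) (0≤+ (x≤0⇒0≤-x a≤0) (x≤0⇒0≤-x a≤0))))
        (solve 4 (λ x a s σ → x :* (a :+ a) :+ (s :+ x :* σ :+ x :* (:- a :+ :- a)) := s :+ x :* σ)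
          refl x (1# + z) s σ)))
    where
    x = x₀ * x₁
    z = - (½ * (y₀ + y₁))
    0<x : 0# < x
    0<x = 0<* 0<x₀ 0<x₁
    sum≈0 : z + z + (y₀ + y₁) ≈ 0#
    sum≈0 = trans (modulo ½+½≈1 (y₀ + y₁))
      (solve 2 (λ h y → :- (h :* y) :+ :- (h :* y) :+ y :+ y :* (h :+ h :- :1) := :0) refl ½ (y₀ + y₁))
    2a≤ : 0# < 1# + z → (1# + z) + (1# + z) ≤ (1# + z) * (1# + z) * s + σ
    2a≤ 0<a = *-cancelʳ-≤ 0<s (≤-by (0≤+ (0≤x² ((1# + z) * s - 1#)) (≤⇒0≤- 1≤sσ))
      (solve 3 (λ a s σ → (a :+ a) :* s :+ ((a :* s :- :1) :* (a :* s :- :1) :+ (s :* σ :- :1))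
         := (a :* a :* s :+ σ) :* s) refl (1# + z) s σ))

  -- The N-th approximant (1 + y / N)ᴺ lies between the two sides. Read contrapositively, the lemma
  -- bounds a logarithm from above.
  exp-power-≤ : ∀ N {α y x} → 0# ≤ α → ι N * α ≤ y → Exp y x → (1# + α) ^ N ≤ x
  -- The approximants start at exponent 1, so for N = 0 the first one, 1 + y, takes over.
  exp-power-≤ zero {α} {y} 0≤α 0≤y exp = ≤-trans
    (≤-by 0≤y₀ (trans (modulo (base-scaled y 0) 1#) (solve 2 (λ y b →
      :1 :+ y :+ :1 :* (b :* (1 :× :1) :- ((1 :× :1) :+ y)) := b :* :1) refl y (base y 0))))
    (expApprox-≤ 0 exp (0≤+ (0≤ι 1) 0≤y₀))
    where
    0≤y₀ : 0# ≤ y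
    0≤y₀ = ≤-respˡ-≈ (zeroˡ α) 0≤y
  exp-power-≤ (suc n) {α} {y} 0≤α Nα≤y exp = ≤-trans
    (^-monoˡ-≤ (suc n) (0≤+ 0≤1 0≤α) (*-cancelʳ-≤ (0<ι (suc n))
      (≤-respˡ-≈ (solve 2 (λ k a → k :+ k :* a := (:1 :+ a) :* k) refl (ι (suc n)) α)
        (≤-respʳ-≈ (sym (base-scaled y n)) (+-monoʳ-≤ (ι (suc n)) Nα≤y)))))
    (expApprox-≤ n exp (0≤+ (0≤ι (suc n)) (≤-trans (0≤* (0≤ι (suc n)) 0≤α) Nα≤y)))

-- The gap between the binary entropy and 1

module EntropyGap {c ℓ} (ℝ : Reals c ℓ) where
  open NoisyOR ℝ hiding (zero)
  open Log2 ℝ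
  open OrderProperties ℝ
  open Logarithms ℝ
  open IntegerCoefficients commutativeRing

  -- The first approximant of exp already gives 1 + log 2 ≤ 2.
  log2≤1 : log (ι 2) (0<ι 2) ≤ 1#
  log2≤1 = ≤-by (≤⇒0≤- (expApprox-≤ 0 (exp-log (ι 2) (0<ι 2))
      (≤-trans (<⇒≤ 0<log2) (≤-by (0≤ι 1) (+-comm _ _)))))
    (trans (modulo (base-scaled (log (ι 2) (0<ι 2)) 0) 1#)
      (solve 2 (λ L b → L :+ ((2 :× :1) :- b :* :1) :+ :1 :* (b :* (1 :× :1) :- ((1 :× :1) :+ L)) := :1)
        refl (log (ι 2) (0<ι 2)) (base (log (ι 2) (0<ι 2)) 0)))

  module _ {p : Carrier} (0<p : 0# < p) (p<½ : p < ½) where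
    private
      q e d L lp lq Y : Carrier
      q = 1# - p
      e = 1# - ι 2 * p
      d = ½ - p
      L = log (ι 2) (0<ι 2)
      lp = log p 0<p
      lq = log q (0<1-p p 0<p p<½)
      -- `Y` is (1 - H(p)) log 2, the gap in nats.
      Y = L + p * lp + q * lq

    0<d : 0# < d
    0<d = <⇒0<- p<½

    2d+2p≈1 : d + d + ι 2 * p ≈ 1#
    2d+2p≈1 = trans (solve 2 (λ h p → (h :- p) :+ (h :- p) :+ (2 :× :1) :* p := h :+ h) refl ½ p) ½+½≈1

    e≈2d : e ≈ d + d
    e≈2d = trans (modulo 2d+2p≈1 1#)
      (solve 2 (λ p d → :1 :- (2 :× :1) :* p :+ :1 :* (d :+ d :+ (2 :× :1) :* p :- :1) := d :+ d) refl p d)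

    0<e : 0# < e
    0<e = <-respʳ-≈ (sym e≈2d) (0<+ 0<d 0<d)

    -- 2 Y is the sum of x log x over x = 2p = 1 - 2d and x = 2 (1 - p) = 1 + 2d. In `log-lower`, s
    -- is taken to be 1 - d and 1 + d, the first-order approximations of the square roots of x. The
    -- first-order terms cancel, leaving d² and the nonnegative rest d² (2p + 4d²).
    d²≤2Y : d * d ≤ Y + Y
    d²≤2Y = ≤-by
      (0≤+ (0≤+ (≤⇒0≤- (log-lower (exp-log _ (0<ι 2)) (exp-log p 0<p) (0<ι 2) 0<p 0<1-d 0≤σ₋ 1≤s₋σ₋))
                (≤⇒0≤- (log-lower (exp-log _ (0<ι 2)) (exp-log q 0<q) (0<ι 2) 0<q (0<+ 0<1 0<d) 0≤σ₊ 1≤s₊σ₊)))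
           (0≤* (0≤x² d) (0≤+ (<⇒≤ 0<2p) (0≤* (0≤ι 4) (0≤x² d)))))
      (trans (modulo 2d+2p≈1 (- (σ₋ - σ₊ + d * d)))
        (solve 5 (λ d p L lp lq →
          let p₂ = (2 :× :1) :* p
              q′ = :1 :- p
              q₂ = (2 :× :1) :* q′
              s₋ = :1 :- d
              s₊ = :1 :+ d
              σ₋ = :1 :+ d :+ d :* d :+ (2 :× :1) :* (d :* d :* d)
              σ₊ = :1 :- d :+ d :* d
              Y = L :+ p :* lp :+ q′ :* lq
          in d :* d :+ ((s₋ :+ p₂ :* σ₋ :- p₂ :* (:1 :+ :1 :- (L :+ lp)))
                     :+ (s₊ :+ q₂ :* σ₊ :- q₂ :* (:1 :+ :1 :- (L :+ lq)))
                     :+ d :* d :* (p₂ :+ (4 :× :1) :* (d :* d)))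
              :+ :- (σ₋ :- σ₊ :+ d :* d) :* (d :+ d :+ p₂ :- :1) := Y :+ Y)
          refl d p L lp lq))
      where
      0<q = 0<1-p p 0<p p<½
      0<2p : 0# < ι 2 * p
      0<2p = 0<* (0<ι 2) 0<p
      -- σ₋ and σ₊ are polynomial upper bounds for 1 / (1 - d) and 1 / (1 + d).
      σ₋ = 1# + d + d * d + ι 2 * (d * d * d)
      σ₊ = 1# - d + d * d
      0<1-d : 0# < 1# - d
      0<1-d = <-respʳ-≈ (trans (modulo 2d+2p≈1 (- 1#))
        (solve 2 (λ d p → d :+ (2 :× :1) :* p :+ :- :1 :* (d :+ d :+ (2 :× :1) :* p :- :1) := :1 :- d) refl d p))
        (0<+ 0<d 0<2p)
      0≤d = <⇒≤ 0<d
      0≤σ₋ : 0# ≤ σ₋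
      0≤σ₋ = 0≤+ (0≤+ (0≤+ 0≤1 0≤d) (0≤x² d)) (0≤* (0≤ι 2) (0≤* (0≤x² d) 0≤d))
      0≤σ₊ : 0# ≤ σ₊
      0≤σ₊ = 0≤+ (<⇒≤ 0<1-d) (0≤x² d)
      1≤s₋σ₋ : 1# ≤ (1# - d) * σ₋
      1≤s₋σ₋ = ≤-by (0≤* (0≤* (0≤x² d) 0≤d) (<⇒≤ 0<2p)) (trans (modulo 2d+2p≈1 (- (d * d * d)))
        (solve 2 (λ d p → :1 :+ d :* d :* d :* ((2 :× :1) :* p) 
            :+ :- (d :* d :* d) :* (d :+ d :+ (2 :× :1) :* p :- :1)
          := (:1 :- d) :* (:1 :+ d :+ d :* d :+ (2 :× :1) :* (d :* d :* d))) refl d p))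
      1≤s₊σ₊ : 1# ≤ (1# + d) * σ₊
      1≤s₊σ₊ = ≤-by (0≤* (0≤x² d) 0≤d)
        (solve 1 (λ d → :1 :+ d :* d :* d := (:1 :+ d) :* (:1 :- d :+ d :* d)) refl d)

    -- Here e² = 4 d² ≤ 8 Y, and dividing `Y` by log 2 ≤ 1 to change from nats to bits does not
    -- decrease it.
    entropy-gap : e * e ≤ ι 8 * (1# - H p 0<p p<½)
    entropy-gap = ≤-respˡ-≈ (sym (*-cong e≈2d e≈2d)) (≤-by
      (0≤+ (0≤* (0≤* (0≤ι 4) (≤⇒0≤- d²≤2Y)) (<⇒≤ 0<i)) (0≤* (0≤* (0≤ι 4) (0≤x² d)) (≤⇒0≤- 1≤i)))
      (trans (modulo (⁻¹-inverse L 0<log2) (- ι 8))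
        (solve 6 (λ d p L lp lq i →
          let q′ = :1 :- p
              Y = L :+ p :* lp :+ q′ :* lq
          in (d :+ d) :* (d :+ d) :+ ((4 :× :1) :* (Y :+ Y :- d :* d) :* i :+ (4 :× :1) :* (d :* d) :* (i :- :1))
            :+ :- (8 :× :1) :* (L :* i :- :1)
          := (8 :× :1) :* (:1 :- (:- (p :* (lp :* i)) :- q′ :* (lq :* i)))) refl d p L lp lq i)))
      where
      i = L ⁻¹[ 0<log2 ]
      0<i = 0<⁻¹ L 0<log2
      1≤i : 1# ≤ i
      1≤i = *-cancelʳ-≤ 0<log2 (≤-respˡ-≈ (sym (*-identityˡ L))
        (≤-respʳ-≈ (sym (trans (*-comm _ _) (⁻¹-inverse L 0<log2))) log2≤1))

    0<1-H : 0# < 1# - H p 0<p p<½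
    0<1-H = *-cancelʳ-< (0<ι 8) (<-respˡ-≈ (sym (zeroˡ _)) (<-respʳ-≈ (*-comm _ _)
      (<-≤-trans (0<* 0<e 0<e) entropy-gap)))

-- Finite summation operators

module Summation {c ℓ} (ℝ : Reals c ℓ) where
  open NoisyOR ℝ hiding (zero)
  open Log2 ℝ
  open OrderProperties ℝ
  open MeanInequalities ℝ
  open IntegerCoefficients commutativeRing
  open SemiringSum semiring using (sum-cong-≋; ∑-distrib-+; *-distribˡ-sum)

  -- Positive linear functionals. Sums over indices, bits, pairs and histories are all instances, so
  -- the moment computations are independent of the shape of the sample space.
  record IsSummation {A : Set} (∑ : (A → Carrier) → Carrier) : Set (c ⊔ ℓ) where
    field
      ∑-cong : ∀ {f g} → (∀ x → f x ≈ g x) → ∑ f ≈ ∑ g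
      ∑-+    : ∀ f g → ∑ (λ x → f x + g x) ≈ ∑ f + ∑ g
      ∑-*    : ∀ k f → ∑ (λ x → k * f x) ≈ k * ∑ f
      ∑-mono : ∀ {f g} → (∀ x → f x ≤ g x) → ∑ f ≤ ∑ g

    ∑-0 : ∑ (λ _ → 0#) ≈ 0#
    ∑-0 = trans (∑-cong (λ _ → sym (zeroˡ 0#))) (trans (∑-* 0# (λ _ → 0#)) (zeroˡ _))

    ∑-*ʳ : ∀ k f → ∑ (λ x → f x * k) ≈ ∑ f * k
    ∑-*ʳ k f = trans (∑-cong (λ _ → *-comm _ _)) (trans (∑-* k f) (*-comm _ _))

    ∑-sum : ∀ {n} (f : Fin n → A → Carrier) → ∑ (λ x → sum λ i → f i x) ≈ sum λ i → ∑ (f i)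
    ∑-sum {zero}  f = ∑-0
    ∑-sum {suc n} f = trans (∑-+ (f zero) (λ x → sum λ i → f (suc i) x)) (+-congˡ (∑-sum (f ∘ suc)))

  open IsSummation

  sum-isSummation : ∀ {n} → IsSummation (sum {n})
  sum-isSummation = record
    { ∑-cong = sum-cong-≋ ; ∑-+ = ∑-distrib-+
    ; ∑-* = λ k f → sym (*-distribˡ-sum k f) ; ∑-mono = sum-mono-≤ }

  ∑ᵇ-isSummation : IsSummation ∑ᵇ
  ∑ᵇ-isSummation = record
    { ∑-cong = λ f≈g → +-cong (f≈g false) (f≈g true)
    ; ∑-+ = λ f g → solve 4 (λ a b c d → (a :+ b) :+ (c :+ d) := (a :+ c) :+ (b :+ d)) refl _ _ _ _
    ; ∑-* = λ k f → sym (distribˡ k _ _)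
    ; ∑-mono = λ f≤g → +-mono-≤ (f≤g false) (f≤g true) }

  ×-isSummation : ∀ {A B} {∑ᴬ ∑ᴮ} → IsSummation {A} ∑ᴬ → IsSummation {B} ∑ᴮ →
                  IsSummation (λ f → ∑ᴬ λ x → ∑ᴮ λ y → f (x , y))
  ×-isSummation a b = record
    { ∑-cong = λ f≈g → ∑-cong a λ x → ∑-cong b λ y → f≈g (x , y)
    ; ∑-+ = λ f g → trans (∑-cong a λ x → ∑-+ b (λ y → f (x , y)) (λ y → g (x , y))) (∑-+ a _ _)
    ; ∑-* = λ k f → trans (∑-cong a λ x → ∑-* b k (λ y → f (x , y))) (∑-* a k _)
    ; ∑-mono = λ f≤g → ∑-mono a λ x → ∑-mono b λ y → f≤g (x , y) }

  ∑ᵛ-isSummation : ∀ {A : Set} {∑ : (A → Carrier) → Carrier} → IsSummation ∑ → ∀ n → IsSummation (∑ᵛ ∑ n)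
  ∑ᵛ-isSummation a zero = record
    { ∑-cong = λ f≈g → f≈g [] ; ∑-+ = λ _ _ → refl ; ∑-* = λ _ _ → refl ; ∑-mono = λ f≤g → f≤g [] }
  ∑ᵛ-isSummation a (suc n) = record
    { ∑-cong = λ f≈g → ∑-cong a λ x → ∑-cong v λ xs → f≈g (x ∷ xs)
    ; ∑-+ = λ f g → trans (∑-cong a λ x → ∑-+ v (λ xs → f (x ∷ xs)) (λ xs → g (x ∷ xs))) (∑-+ a _ _)
    ; ∑-* = λ k f → trans (∑-cong a λ x → ∑-* v k (λ xs → f (x ∷ xs))) (∑-* a k _)
    ; ∑-mono = λ f≤g → ∑-mono a λ x → ∑-mono v λ xs → f≤g (x ∷ xs) }
    where v = ∑ᵛ-isSummation a n

  -- Distributivity, used as independence of the rounds: the expectation of a product over rounds is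
  -- the product of the expectations.
  ∑ᵛ-product : ∀ {A : Set} {∑ : (A → Carrier) → Carrier} → IsSummation ∑ → ∀ {n} (f : Fin n → A → Carrier) →
               ∑ᵛ ∑ n (λ xs → product λ i → f i (lookup xs i)) ≈ product λ i → ∑ (f i)
  ∑ᵛ-product a {zero}  f = refl
  ∑ᵛ-product a {suc n} f = trans
    (∑-cong a λ x → trans (∑-* (∑ᵛ-isSummation a n) (f zero x) _) (*-congˡ (∑ᵛ-product a (f ∘ suc))))
    (∑-*ʳ a _ (f zero))

  ∑ʰ-isSummation : ∀ K T → IsSummation (∑ʰ K T)
  ∑ʰ-isSummation K T = ∑ᵛ-isSummation (×-isSummation sum-isSummation ∑ᵇ-isSummation) T

  sum-single : ∀ {n} (f : Fin n → Carrier) j → (∀ i → i ≢ j → f i ≈ 0#) → sum f ≈ f j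
  sum-single {suc n} f zero    f≈0 = trans
    (+-congˡ (trans (∑-cong sum-isSummation λ i → f≈0 (suc i) λ ()) (∑-0 (sum-isSummation {n}))))
    (+-identityʳ _)
  sum-single {suc n} f (suc j) f≈0 = trans (+-cong (f≈0 zero λ ())
    (sum-single (f ∘ suc) j λ i i≢j → f≈0 (suc i) (i≢j ∘ Finₚ.suc-injective))) (+-identityˡ _)

  -- Cauchy-Schwarz for the covariance of W and q; the factor 4 is there because
  -- the variance of a variable with values in [0, 1] is at most 1/4.
  covariance-bound : ∀ {A : Set} {∑ : (A → Carrier) → Carrier} → IsSummation ∑ → (P W q : A → Carrier) →
    (∀ x → 0# ≤ P x) → (∀ x → 0# ≤ q x) → (∀ x → q x ≤ 1#) → ∑ P ≈ 1# → ∑ (λ x → P x * W x) ≈ 0# →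
    ι 4 * (∑ (λ x → P x * W x * q x) * ∑ (λ x → P x * W x * q x)) ≤ ∑ (λ x → P x * (W x * W x))
  covariance-bound {∑ = ∑} a P W q 0≤P 0≤q q≤1 ∑P≈1 ∑PW≈0 = 0≤-⇒≤
    (≤-respʳ-≈ (solve 2 (λ S V → V :+ (4 :× :1) :* (S :* S) :- (8 :× :1) :* S :* S
                                   := V :- (4 :× :1) :* (S :* S)) refl S V)
      (≤⇒0≤- (≤-respˡ-≈ (∑-* a (ι 8 * S) _) (≤-respʳ-≈ total≈ (∑-mono a pointwise)))))
    where
    S = ∑ (λ x → P x * W x * q x)
    V = ∑ (λ x → P x * (W x * W x))
    -- Expands P (W - 2 S (2 q - 1))² ≥ 0. The term 16 S² P q (1 - q) replaces (2 q - 1)² by its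
    -- upper bound 1.
    pointwise : ∀ x → ι 8 * S * (P x * W x * q x)
                    ≤ P x * (W x * W x) + (ι 4 * S * (P x * W x) + ι 4 * (S * S) * P x)
    pointwise x = ≤-by (0≤+ (0≤* (0≤P x) (0≤x² (W x - ι 2 * S * (ι 2 * q x - 1#))))
        (0≤* (0≤* (0≤* (0≤ι 16) (0≤x² S)) (0≤P x)) (0≤* (0≤q x) (≤⇒0≤- (q≤1 x)))))
      (solve 4 (λ P W q S →
        let w = W :- (2 :× :1) :* S :* ((2 :× :1) :* q :- :1) in
        (8 :× :1) :* S :* (P :* W :* q) :+ (P :* (w :* w) :+ (16 :× :1) :* (S :* S) :* P :* (q :* (:1 :- q)))
        := P :* (W :* W) :+ ((4 :× :1) :* S :* (P :* W) :+ (4 :× :1) :* (S :* S) :* P))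
        refl (P x) (W x) (q x) S)
    total≈ : ∑ (λ x → P x * (W x * W x) + (ι 4 * S * (P x * W x) + ι 4 * (S * S) * P x))
             ≈ V + ι 4 * (S * S)
    total≈ = trans (∑-+ a _ _) (+-congˡ (trans (∑-+ a _ _) (trans
      (+-cong (trans (∑-* a _ _) (trans (*-congˡ ∑PW≈0) (zeroʳ _)))
              (trans (∑-* a _ _) (trans (*-congˡ ∑P≈1) (*-identityʳ _)))) (+-identityˡ _))))

-- The second moment method

OR-replicate : ∀ K → OR (Vec.replicate K false) ≡ false
OR-replicate zero    = ≡.refl
OR-replicate (suc K) = OR-replicate K

OR-lookup : ∀ {K} (θ : Vec Bool K) k → lookup θ k ≡ true → OR θ ≡ true
OR-lookup (true ∷ θ) zero    eq = ≡.refl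
OR-lookup (b ∷ θ)    (suc k) eq = ≡.trans (≡.cong (b ∨_) (OR-lookup θ k eq)) (∨-zeroʳ b)

only : ∀ {K} → Fin K → Vec Bool K
only j = tabulate λ k → does (k Finₚ.≟ j)

OR-only : ∀ {K} (j : Fin K) → OR (only j) ≡ true
OR-only j = OR-lookup (only j) j (≡.trans (lookup∘tabulate _ j) (dec-true (j Finₚ.≟ j) ≡.refl))

module Testing {c ℓ} (ℝ : Reals c ℓ) where
  open NoisyOR ℝ hiding (zero)
  open Log2 ℝ
  open OrderProperties ℝ
  open MeanInequalities ℝ
  open Summation ℝ
  open IsSummation
  open IntegerCoefficients commutativeRing
  open SemiringSum semiring using (*-distribˡ-sum; *-distribʳ-sum)

  product-1 : ∀ {n} {f : Fin n → Carrier} → (∀ i → f i ≈ 1#) → product f ≈ 1#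
  product-1 {n} f≈1 = trans (Product.sum-cong-≋ f≈1) (trans (product-const n 1#) (1^ n))

  maxᵛ-upper : ∀ K f (θ : Vec Bool K) → f θ ≤ maxᵛ K f
  maxᵛ-upper zero    f []          = ≤-refl
  maxᵛ-upper (suc K) f (false ∷ θ) = ≤-trans (maxᵛ-upper K (f ∘ (false ∷_)) θ) (proj₁ (⊔ʳ-supremum _ _))
  maxᵛ-upper (suc K) f (true ∷ θ)  = ≤-trans (maxᵛ-upper K (f ∘ (true ∷_)) θ) (proj₁ (proj₂ (⊔ʳ-supremum _ _)))

  indicator : Bool → Carrier
  indicator b = if b then 1# else 0#

  δ : ∀ {K} → Fin K → Fin K → Carrier
  δ j k = indicator (does (k Finₚ.≟ j))

  0≤δ : ∀ {K} (j k : Fin K) → 0# ≤ δ j k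
  0≤δ j k with does (k Finₚ.≟ j)
  ... | true  = 0≤1
  ... | false = ≤-refl

  δ≤1 : ∀ {K} (j k : Fin K) → δ j k ≤ 1#
  δ≤1 j k with does (k Finₚ.≟ j)
  ... | true  = ≤-refl
  ... | false = 0≤1

  δ-refl : ∀ {K} (j : Fin K) → δ j j ≈ 1#
  δ-refl j = reflexive (≡.cong indicator (dec-true (j Finₚ.≟ j) ≡.refl))

  δ-≢ : ∀ {K} {j k : Fin K} → k ≢ j → δ j k ≈ 0#
  δ-≢ {j = j} {k} k≢j = reflexive (≡.cong indicator (dec-false (k Finₚ.≟ j) k≢j))

  sum-δ : ∀ {K} (f : Fin K → Carrier) j → sum (λ k → f k * δ j k) ≈ f j
  sum-δ f j = trans (sum-single _ j λ i i≢j → trans (*-congˡ (δ-≢ i≢j)) (zeroʳ _))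
    (trans (*-congˡ (δ-refl j)) (*-identityʳ _))

  module _ {p : Carrier} (0<p : 0# < p) (p<½ : p < ½) where

    private
      p⁻¹ q⁻¹ : Carrier
      p⁻¹ = p ⁻¹[ 0<p ]
      q⁻¹ = (1# - p) ⁻¹[ 0<1-p p 0<p p<½ ]
      pp⁻¹≈1 : p * p⁻¹ ≈ 1#
      pp⁻¹≈1 = ⁻¹-inverse p 0<p
      qq⁻¹≈1 : (1# - p) * q⁻¹ ≈ 1#
      qq⁻¹≈1 = ⁻¹-inverse (1# - p) (0<1-p p 0<p p<½)

    -- 1 + ξ y is the likelihood ratio of the observation y under the inputs 1 and 0.
    ξ : Bool → Carrier
    ξ true  = (1# - ι 2 * p) * p⁻¹
    ξ false = - ((1# - ι 2 * p) * q⁻¹)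

    -- The chi-squared divergence between the channel outputs for inputs 1 and 0, equal to e² / (p
    -- (1 - p)).
    χ² : Carrier
    χ² = (1# - ι 2 * p) * (1# - ι 2 * p) * (p⁻¹ + q⁻¹)

    0≤χ² : 0# ≤ χ²
    0≤χ² = 0≤* (0≤x² _) (0≤+ (<⇒≤ (0<⁻¹ p 0<p)) (<⇒≤ (0<⁻¹ (1# - p) _)))

    0≤bsc : ∀ x y → 0# ≤ bsc p x y
    0≤bsc x y with x xor y
    ... | true  = <⇒≤ 0<p
    ... | false = <⇒≤ (0<1-p p 0<p p<½)

    bsc-ratio : ∀ x y → bsc p x y ≈ bsc p false y * (1# + indicator x * ξ y)
    bsc-ratio false y = solve 2 (λ b x → b := b :* (:1 :+ :0 :* x)) refl _ (ξ y)
    bsc-ratio true true = trans (modulo pp⁻¹≈1 (1# - ι 2 * p))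
      (solve 2 (λ p i → :1 :- p :+ (:1 :- (2 :× :1) :* p) :* (p :* i :- :1)
        := p :* (:1 :+ :1 :* ((:1 :- (2 :× :1) :* p) :* i))) refl p p⁻¹)
    bsc-ratio true false = trans (modulo qq⁻¹≈1 (- (1# - ι 2 * p)))
      (solve 2 (λ p i → p :+ :- (:1 :- (2 :× :1) :* p) :* ((:1 :- p) :* i :- :1)
        := (:1 :- p) :* (:1 :+ :1 :* :- ((:1 :- (2 :× :1) :* p) :* i))) refl p q⁻¹)

    -- Under input 0, `ξ` has mean 0 and variance `χ²`.
    bsc-moment : ∀ a b → ∑ᵇ (λ y → bsc p false y * ((1# + a * ξ y) * (1# + b * ξ y))) ≈ 1# + χ² * (a * b)
    bsc-moment a b = trans (modulo pp⁻¹≈1 (- (e′ * (a + b) + e′ * e′ * p⁻¹ * (a * b))))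
      (trans (modulo qq⁻¹≈1 (e′ * (a + b) - e′ * e′ * q⁻¹ * (a * b)))
      (solve 5 (λ p i j a b →
        let e = :1 :- (2 :× :1) :* p
            x = e :* i
            y = :- (e :* j)
        in (:1 :- p) :* ((:1 :+ a :* y) :* (:1 :+ b :* y)) :+ p :* ((:1 :+ a :* x) :* (:1 :+ b :* x))
           :+ :- (e :* (a :+ b) :+ e :* e :* i :* (a :* b)) :* (p :* i :- :1)
           :+ (e :* (a :+ b) :- e :* e :* j :* (a :* b)) :* ((:1 :- p) :* j :- :1)
           := :1 :+ e :* e :* (i :+ j) :* (a :* b)) refl p p⁻¹ q⁻¹ a b))
      where e′ = 1# - ι 2 * p

    module _ {K T} (alg : NonAdaptive K T) where

      private
        π : Fin T → Fin K → Carrier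
        π t = prob (sampling alg t)
        ∑ = ∑ʰ K T
        is∑ = ∑ʰ-isSummation K T
        is∑ᴷ = sum-isSummation {K}

      -- P₀ is the law of the history for θ = 0, and Λ (δ j) the likelihood ratio of only j.
      P₀ : History K T → Carrier
      P₀ h = product λ t → let (k , y) = lookup h t in π t k * bsc p false y

      Λ : (Fin K → Carrier) → History K T → Carrier
      Λ a h = product λ t → let (k , y) = lookup h t in 1# + a k * ξ y

      Q : History K T → Carrier
      Q h = prob (output alg h) true

      0≤P₀ : ∀ h → 0# ≤ P₀ h
      0≤P₀ h = 0≤product {T} λ t → 0≤* (nonneg (sampling alg t) _) (0≤bsc false (proj₂ (lookup h t)))

      P₀-expectation : ∀ (g : Fin T → Fin K × Bool → Carrier) →
        ∑ (λ h → P₀ h * product λ t → g t (lookup h t))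
        ≈ product λ t → sum λ k → π t k * ∑ᵇ λ y → bsc p false y * g t (k , y)
      P₀-expectation g = trans
        (∑-cong is∑ λ h → sym (Product.∑-distrib-+ {T} _ (λ t → g t (lookup h t))))
        (trans (∑ᵛ-product (×-isSummation is∑ᴷ ∑ᵇ-isSummation) {T}
            (λ t (k , y) → π t k * bsc p false y * g t (k , y)))
          (Product.sum-cong-≋ {T} λ t → ∑-cong is∑ᴷ λ k →
            trans (∑-cong ∑ᵇ-isSummation λ y → *-assoc (π t k) (bsc p false y) (g t (k , y)))
                  (∑-* ∑ᵇ-isSummation (π t k) (λ y → bsc p false y * g t (k , y)))))

      -- All moments below are cases of this one: a = 0 gives the total masses, a = b = `δ j` the
      -- variance of a likelihood ratio, and a, b with disjoint supports the orthogonality.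
      Λ-moment : ∀ a b → ∑ (λ h → P₀ h * (Λ a h * Λ b h))
                         ≈ product λ t → 1# + χ² * sum λ k → π t k * (a k * b k)
      Λ-moment a b = trans
        (∑-cong is∑ λ h → *-congˡ (sym (Product.∑-distrib-+ {T} _ _)))
        (trans (P₀-expectation (λ t (k , y) → (1# + a k * ξ y) * (1# + b k * ξ y)))
        (Product.sum-cong-≋ {T} λ t → trans
          (∑-cong is∑ᴷ λ k → trans (*-congˡ (bsc-moment (a k) (b k)))
            (solve 3 (λ π x ab → π :* (:1 :+ x :* ab) := π :+ x :* (π :* ab)) refl (π t k) χ² (a k * b k)))
          (trans (∑-+ is∑ᴷ (π t) _) (+-cong (total (sampling alg t)) (∑-* is∑ᴷ χ² _)))))

      Λ-0 : ∀ h → Λ (λ _ → 0#) h ≈ 1#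
      Λ-0 h = product-1 {T} λ t → trans (+-congˡ (zeroˡ (ξ (proj₂ (lookup h t))))) (+-identityʳ 1#)

      moment-1 : ∀ a b → (∀ k → a k * b k ≈ 0#) → ∑ (λ h → P₀ h * (Λ a h * Λ b h)) ≈ 1#
      moment-1 a b ab≈0 = trans (Λ-moment a b) (product-1 {T} λ t → trans (+-congˡ (trans (*-congˡ (trans
        (∑-cong is∑ᴷ λ k → trans (*-congˡ (ab≈0 k)) (zeroʳ (π t k))) (∑-0 is∑ᴷ)))
        (zeroʳ χ²))) (+-identityʳ 1#))

      P₀-total : ∑ P₀ ≈ 1#
      P₀-total = trans
        (∑-cong is∑ λ h → sym (trans (*-congˡ (trans (*-cong (Λ-0 h) (Λ-0 h)) (*-identityʳ 1#))) (*-identityʳ _)))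
        (moment-1 (λ _ → 0#) (λ _ → 0#) (λ _ → zeroˡ 0#))

      Λ-total : ∀ a → ∑ (λ h → P₀ h * Λ a h) ≈ 1#
      Λ-total a = trans (∑-cong is∑ λ h → *-congˡ (sym (trans (*-congʳ (Λ-0 h)) (*-identityˡ _))))
        (moment-1 (λ _ → 0#) a (λ _ → zeroˡ _))

      -- The chi-squared divergence of the law of `only j` from `P₀`, as `excess-square` confirms.
      divergence : Fin K → Carrier
      divergence j = (product λ t → 1# + χ² * π t j) - 1#

      excess : Fin K → History K T → Carrier
      excess j h = Λ (δ j) h - 1#

      excess-total : ∀ j → ∑ (λ h → P₀ h * excess j h) ≈ 0#
      excess-total j = trans
        (∑-cong is∑ λ h → solve 2 (λ P x → P :* (x :- :1) := P :* x :+ :- :1 :* P) refl (P₀ h) _)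
        (trans (∑-+ is∑ _ _) (trans (+-cong (Λ-total (δ j)) (trans (∑-* is∑ _ _) (*-congˡ P₀-total)))
          (solve 0 (:1 :+ :- :1 :* :1 := :0) refl)))

      excess-product : ∀ i j → ∑ (λ h → P₀ h * (excess i h * excess j h))
                               ≈ (∑ λ h → P₀ h * (Λ (δ i) h * Λ (δ j) h)) - 1#
      excess-product i j = trans (∑-cong is∑ λ h → solve 3 (λ P x y → P :* ((x :- :1) :* (y :- :1))
          := P :* (x :* y) :+ (:- :1 :* (P :* x) :+ (:- :1 :* (P :* y) :+ P))) refl (P₀ h) _ _)
        (trans (∑-+ is∑ _ _) (+-congˡ (trans (∑-+ is∑ _ _) (trans (+-congˡ (∑-+ is∑ _ _))
          (trans (+-cong (trans (∑-* is∑ _ _) (*-congˡ (Λ-total (δ i))))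
            (+-cong (trans (∑-* is∑ _ _) (*-congˡ (Λ-total (δ j)))) P₀-total))
            (solve 0 (:- :1 :* :1 :+ (:- :1 :* :1 :+ :1) := :- :1) refl))))))

      -- A query has a single index, so it cannot inform about both i and j, and the cross term of
      -- every round vanishes.
      excess-orthogonal : ∀ {i j} → i ≢ j → ∑ (λ h → P₀ h * (excess i h * excess j h)) ≈ 0#
      excess-orthogonal {i} {j} i≢j = trans (excess-product i j)
        (trans (+-congʳ (moment-1 (δ i) (δ j) disjoint)) (-‿inverseʳ 1#))
        where
        disjoint : ∀ k → δ i k * δ j k ≈ 0#
        disjoint k with k Finₚ.≟ i
        ... | yes ≡.refl = trans (*-congˡ (δ-≢ i≢j)) (zeroʳ _)
        ... | no  _      = zeroˡ _

      excess-square : ∀ j → ∑ (λ h → P₀ h * (excess j h * excess j h)) ≈ divergence j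
      excess-square j = trans (excess-product j j) (+-congʳ (trans (Λ-moment (δ j) (δ j))
        (Product.sum-cong-≋ {T} λ t → +-congˡ (*-congˡ (trans
          (∑-cong is∑ᴷ λ k → sym (*-assoc (π t k) (δ j k) (δ j k)))
          (trans (sum-δ (λ k → π t k * δ j k) j) (trans (*-congˡ (δ-refl j)) (*-identityʳ _))))))))

      historyProb-false : ∀ h → historyProb p alg (Vec.replicate K false) h ≈ P₀ h
      historyProb-false h = Product.sum-cong-≋ {T} λ t →
        reflexive (≡.cong (λ b → π t (proj₁ (lookup h t)) * bsc p b (proj₂ (lookup h t)))
          (lookup-replicate (proj₁ (lookup h t)) false))

      historyProb-only : ∀ j h → historyProb p alg (only j) h ≈ P₀ h * Λ (δ j) h
      historyProb-only j h = trans (Product.sum-cong-≋ {T} λ t → trans (*-congˡ (trans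
          (reflexive (≡.cong (λ b → bsc p b (proj₂ (lookup h t))) (lookup∘tabulate _ (proj₁ (lookup h t)))))
          (bsc-ratio (does (proj₁ (lookup h t) Finₚ.≟ j)) (proj₂ (lookup h t)))))
          (sym (*-assoc _ _ _)))
        (Product.∑-distrib-+ {T} _ _)

      errorProb-OR : ∀ θ {b} → OR θ ≡ b →
        errorProb p alg θ ≈ ∑ λ h → historyProb p alg θ h * prob (output alg h) (not b)
      errorProb-OR θ {false} eq rewrite eq = ∑-cong is∑ λ h → +-identityˡ _
      errorProb-OR θ {true}  eq rewrite eq = ∑-cong is∑ λ h → +-identityʳ _

      0≤Q : ∀ h → 0# ≤ Q h
      0≤Q h = nonneg (output alg h) true

      false≈1-Q : ∀ h → prob (output alg h) false ≈ 1# - Q h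
      false≈1-Q h = trans (modulo (total (output alg h)) (- 1#))
        (solve 2 (λ f t → f :+ :- :1 :* (f :+ t :- :1) := :1 :- t) refl _ (Q h))

      Q≤1 : ∀ h → Q h ≤ 1#
      Q≤1 h = 0≤-⇒≤ (≤-respʳ-≈ (false≈1-Q h) (nonneg (output alg h) false))

      error-false : errorProb p alg (Vec.replicate K false) ≈ ∑ λ h → P₀ h * Q h
      error-false = trans (errorProb-OR (Vec.replicate K false) (OR-replicate K))
        (∑-cong is∑ λ h → *-congʳ (historyProb-false h))

      error-only : ∀ j → errorProb p alg (only j) ≈ ∑ λ h → P₀ h * Λ (δ j) h * (1# - Q h)
      error-only j = trans (errorProb-OR (only j) (OR-only j))
        (∑-cong is∑ λ h → *-cong (historyProb-only j h) (false≈1-Q h))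

      private M = worstCaseError p alg

      -- The probability of the output `true` under `only j` minus that under θ = 0.
      advantage : Fin K → Carrier
      advantage j = ∑ λ h → P₀ h * excess j h * Q h

      -- The advantage is 1 minus the two error probabilities, each of which is at most the
      -- worst-case error.
      advantage-lower : ∀ j → 1# - ι 2 * M ≤ advantage j
      advantage-lower j = ≤-by (0≤+ (≤⇒0≤- (≤-respˡ-≈ error-false (maxᵛ-upper K _ (Vec.replicate K false))))
                                    (≤⇒0≤- (≤-respˡ-≈ (error-only j) (maxᵛ-upper K _ (only j)))))
        (trans (modulo split (- 1#)) (solve 4 (λ M A B S →
            :1 :- (2 :× :1) :* M :+ ((M :- A) :+ (M :- B)) :+ :- :1 :* (:1 :- (A :+ B :+ S)) := S)
          refl M _ _ (advantage j)))
        where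
        split : 1# ≈ (∑ λ h → P₀ h * Q h) + (∑ λ h → P₀ h * Λ (δ j) h * (1# - Q h)) + advantage j
        split = trans (sym (Λ-total (δ j))) (trans (∑-cong is∑ λ h → solve 3 (λ P x q →
            P :* x := P :* q :+ P :* x :* (:1 :- q) :+ P :* (x :- :1) :* q) refl (P₀ h) _ (Q h))
          (trans (∑-+ is∑ _ _) (+-congʳ (∑-+ is∑ _ _))))

      -- `covariance-bound` for the mixture of the excesses; orthogonality leaves only the diagonal
      -- of its variance. The weights are not normalised, so they may be reciprocals of divergences
      -- as they stand.
      weighted-bound : ∀ (w : Fin K → Carrier) → (∀ j → 0# ≤ w j) → 0# ≤ 1# - ι 2 * M →
        ι 4 * ((sum w * (1# - ι 2 * M)) * (sum w * (1# - ι 2 * M))) ≤ sum λ j → w j * (w j * divergence j)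
      weighted-bound w 0≤w 0≤m = ≤-trans
        (*-monoʳ-≤ (0<ι 4) (*-mono-≤ 0≤Um Um≤S 0≤Um Um≤S))
        (≤-respʳ-≈ variance (covariance-bound is∑ P₀ W Q 0≤P₀ 0≤Q Q≤1 P₀-total W-total))
        where
        W : History K T → Carrier
        W h = sum λ j → w j * excess j h

        linear : ∀ (g : History K T → Carrier) →
          ∑ (λ h → P₀ h * W h * g h) ≈ sum λ j → w j * ∑ λ h → P₀ h * excess j h * g h
        linear g = trans (∑-cong is∑ λ h → trans (trans (*-congʳ (*-distribˡ-sum {K} (P₀ h) _))
              (*-distribʳ-sum {K} (g h) _))
            (∑-cong is∑ᴷ λ j → solve 4 (λ P w x g → P :* (w :* x) :* g := w :* (P :* x :* g))
              refl (P₀ h) (w j) (excess j h) (g h)))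
          (trans (∑-sum is∑ {K} _) (∑-cong is∑ᴷ λ j → ∑-* is∑ (w j) _))

        0≤Um : 0# ≤ sum w * (1# - ι 2 * M)
        0≤Um = 0≤* (0≤sum {K} 0≤w) 0≤m

        Um≤S : sum w * (1# - ι 2 * M) ≤ ∑ λ h → P₀ h * W h * Q h
        Um≤S = ≤-respˡ-≈ (sym (*-distribʳ-sum {K} _ w)) (≤-respʳ-≈ (sym (linear Q))
          (sum-mono-≤ {K} λ j → *-monoʳ-≤₀ (0≤w j) (advantage-lower j)))

        W-total : ∑ (λ h → P₀ h * W h) ≈ 0#
        W-total = trans (∑-cong is∑ λ h → sym (*-identityʳ _)) (trans (linear (λ _ → 1#))
          (trans (∑-cong is∑ᴷ λ j → trans (*-congˡ (trans (∑-cong is∑ λ h → *-identityʳ _)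
            (excess-total j))) (zeroʳ _)) (∑-0 is∑ᴷ)))

        variance : ∑ (λ h → P₀ h * (W h * W h)) ≈ sum λ j → w j * (w j * divergence j)
        variance = trans (∑-cong is∑ λ h → sym (*-assoc (P₀ h) (W h) (W h))) (trans (linear W)
          (∑-cong is∑ᴷ λ j → *-congˡ (trans
            (∑-cong is∑ λ h → solve 3 (λ P x W → P :* x :* W := P :* W :* x) refl (P₀ h) (excess j h) (W h))
            (trans (linear (excess j)) (trans
              (sum-single {K} _ j λ i i≢j → trans (*-congˡ (trans
                (∑-cong is∑ λ h → *-assoc (P₀ h) (excess i h) (excess j h)) (excess-orthogonal i≢j))) (zeroʳ (w i)))
              (*-congˡ (trans (∑-cong is∑ λ h → *-assoc (P₀ h) (excess j h) (excess j h)) (excess-square j))))))))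

-- The minimax bound

nonZero⇒Fin : ∀ n .{{_ : NonZero n}} → Fin n
nonZero⇒Fin (suc n) = zero

module LowerBound {c ℓ} (ℝ : Reals c ℓ) where
  open NoisyOR ℝ hiding (zero)
  open Log2 ℝ
  open OrderProperties ℝ
  open MeanInequalities ℝ
  open Logarithms ℝ
  open Summation ℝ
  open EntropyGap ℝ
  open Testing ℝ
  open IsSummation
  open IntegerCoefficients commutativeRing
  open SemiringSum semiring using (∑-comm)
  open SemiringExp semiring using (^-assocʳ; ^-congˡ)
  open SemiringMult semiring using (×1-homo-*)

  module _ {p : Carrier} (0<p : 0# < p) (p<½ : p < ½) {K T} .{{_ : NonZero K}} (alg : NonAdaptive K T) where

    private
      π : Fin T → Fin K → Carrier
      π t = prob (sampling alg t)
      is∑ = ∑ʰ-isSummation K T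
      is∑ᴷ = sum-isSummation {K}
      is∑ᵀ = sum-isSummation {T}
      0<q = 0<1-p p 0<p p<½
      χ = χ² 0<p p<½
      d = divergence 0<p p<½ alg

    -- `m` is the advantage guaranteed against every alternative; `α` is `χ²` / K, written as in
    -- `minimaxBound`.
    m α D : Carrier
    m = 1# - ι 2 * worstCaseError p alg
    α = (1# - ι 2 * p) ^ 2 / (ι K * (1# - p) * p) [ 0<* (0<* (0<ι K) 0<q) 0<p ]
    D = (1# + α) ^ T - 1#

    0≤m² : 0# ≤ m * m
    0≤m² = 0≤x² m

    Kα≈χ² : ι K * α ≈ χ
    Kα≈χ² = trans (modulo (⁻¹-inverse (1# - p) 0<q) (ι K * e² * I * p))
      (trans (modulo (⁻¹-inverse p 0<p) (ι K * e² * I * (1# - p)))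
      (trans (modulo (⁻¹-inverse (ι K * (1# - p) * p) (0<* (0<* (0<ι K) 0<q) 0<p)) (- (e² * (i + j))))
      (solve 5 (λ K I p i j →
        let e = :1 :- (2 :× :1) :* p
            e² = e :* e
            q′ = :1 :- p
        in K :* (e :* (e :* :1) :* I) :+ K :* e² :* I :* p :* (q′ :* j :- :1)
             :+ K :* e² :* I :* q′ :* (p :* i :- :1)
             :+ :- (e² :* (i :+ j)) :* (K :* q′ :* p :* I :- :1)
           := e :* e :* (i :+ j)) refl (ι K) I p i j)))
      where
      e² = (1# - ι 2 * p) * (1# - ι 2 * p)
      I = (ι K * (1# - p) * p) ⁻¹[ 0<* (0<* (0<ι K) 0<q) 0<p ]
      i = p ⁻¹[ 0<p ]
      j = (1# - p) ⁻¹[ 0<q ]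

    0<α : 0# < α
    0<α = 0<* (0<* 0<e′ (0<* 0<e′ 0<1)) (0<⁻¹ _ _)
      where
      0<e′ : 0# < 1# - ι 2 * p
      0<e′ = 0<e 0<p p<½

    0<1+α : 0# < 1# + α
    0<1+α = 0<+ 0<1 0<α

    Tα≤D : ι T * α ≤ D
    Tα≤D = ≤-by (≤⇒0≤- (bernoulli (<⇒≤ 0<1+α) T))
      (solve 2 (λ x B → x :+ (B :- (:1 :+ x)) := B :- :1) refl (ι T * α) ((1# + α) ^ T))

    0≤D : 0# ≤ D
    0≤D = ≤-trans (0≤* (0≤ι T) (<⇒≤ 0<α)) Tα≤D

    1+D≈ : (1# + α) ^ T ≈ 1# + D
    1+D≈ = solve 1 (λ B → B := :1 :+ (B :- :1)) refl ((1# + α) ^ T)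

    private
      x : Fin K → Fin T → Carrier
      x j t = 1# + χ * π t j

      σ : Carrier
      σ = (1# + α) ⁻¹[ 0<1+α ]

    -- In every round the factors `x j t` have mean 1 + α over j, because the sampling distribution
    -- has total 1. The linear terms of the tangents at 1 + α thus cancel when summed over j.
    deviations-cancel : sum {K} (λ j → sum {T} λ t → x j t * σ - 1#) ≈ 0#
    deviations-cancel = trans (∑-comm {K} {T} _)
      (trans (∑-cong is∑ᵀ λ t → trans (∑-+ is∑ᴷ (λ j → x j t * σ) (λ _ → - 1#))
        (trans (+-cong (trans (∑-*ʳ is∑ᴷ σ _) (*-congʳ (trans (∑-+ is∑ᴷ (λ _ → 1#) _)
              (+-cong (sum-const K 1#) (trans (∑-* is∑ᴷ χ _) (*-congˡ (total (sampling alg t))))))))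
            (sum-const K (- 1#)))
          (trans (+-congʳ (*-congʳ (+-congˡ (*-congʳ (sym Kα≈χ²)))))
            (trans (modulo (⁻¹-inverse (1# + α) 0<1+α) (- ι K))
              (solve 3 (λ K α σ → (K :* :1 :+ K :* α :* :1) :* σ :+ K :* :- :1
                 :+ :- K :* ((:1 :+ α) :* σ :- :1) := :0) refl (ι K) α σ)))))
        (∑-0 is∑ᵀ))

    -- Summing `product-tangent` over j gives K D ≤ D² Σ 1 / d_j.
    harmonic-bound : 0# < D → (0<d : ∀ j → 0# < d j) → ι K ≤ D * sum λ j → d j ⁻¹[ 0<d j ]
    harmonic-bound 0<D 0<d = *-cancelʳ-≤ 0<D (≤-respˡ-≈ (sum-const K D) (≤-respʳ-≈ summed
      (sum-mono-≤ {K} λ j → product-tangent {T} (x j) (λ t → 0≤x j t) (<⇒≤ (0<⁻¹ _ 0<1+α))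
        (⁻¹-inverse (1# + α) 0<1+α) 1+D≈ 0≤D
        (solve 1 (λ B → B := :1 :+ (B :- :1)) refl (product (x j)))
        (0<d j) (<⇒≤ (0<⁻¹ (d j) (0<d j))) (⁻¹-inverse (d j) (0<d j)))))
      where
      u : Fin K → Carrier
      u j = d j ⁻¹[ 0<d j ]
      0≤x : ∀ j t → 0# ≤ x j t
      0≤x j t = 0≤+ 0≤1 (0≤* (0≤χ² 0<p p<½) (nonneg (sampling alg t) j))
      summed : sum {K} (λ j → D * D * u j + (1# + D) * sum {T} λ t → x j t * σ - 1#) ≈ D * sum u * D
      summed = trans (∑-+ is∑ᴷ _ _) (trans (+-cong (∑-* is∑ᴷ (D * D) u)
          (trans (∑-* is∑ᴷ (1# + D) _) (trans (*-congˡ deviations-cancel) (zeroʳ _))))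
        (solve 2 (λ D U → D :* D :* U :+ :0 := D :* U :* D) refl D (sum u)))

    -- If every d_j is positive, the weights 1 / d_j and `harmonic-bound` apply. If some d_j is not,
    -- all the weight goes on that j, and 4 m² ≤ d_j ≤ 0.
    minimax-square : 0# ≤ m → ι 4 * (ι K * (m * m)) ≤ D
    minimax-square 0≤m = ≤-cases-∀ d all-positive one-vanishes
      where
      one-vanishes : ∀ j → d j ≤ 0# → ι 4 * (ι K * (m * m)) ≤ D
      one-vanishes j d≤0 = ≤-trans
        (≤-respˡ-≈ (trans (*-congˡ (*-congˡ (*-cong (*-congʳ U≈1) (*-congʳ U≈1))))
            (solve 2 (λ K m → K :* ((4 :× :1) :* (:1 :* m :* (:1 :* m)))
               := (4 :× :1) :* (K :* (m :* m))) refl (ι K) m))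
          (≤-respʳ-≈ (zeroʳ (ι K)) (*-monoʳ-≤ (0<ι K)
            (≤-trans (weighted-bound 0<p p<½ alg (δ j) (0≤δ j) 0≤m) (≤-respˡ-≈ (sym V≈d) d≤0)))))
        0≤D
        where
        U≈1 : sum (δ j) ≈ 1#
        U≈1 = trans (∑-cong is∑ᴷ λ k → sym (*-identityˡ (δ j k))) (sum-δ (λ _ → 1#) j)
        V≈d : sum (λ k → δ j k * (δ j k * d k)) ≈ d j
        V≈d = trans (∑-cong is∑ᴷ λ k → *-comm _ _)
          (trans (sum-δ (λ k → δ j k * d k) j) (trans (*-congʳ (δ-refl j)) (*-identityˡ (d j))))

      all-positive : (∀ j → 0# < d j) → ι 4 * (ι K * (m * m)) ≤ D
      all-positive 0<d = scaled
        where
        u : Fin K → Carrier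
        u j = d j ⁻¹[ 0<d j ]
        U = sum u
        0<u : ∀ j → 0# < u j
        0<u j = 0<⁻¹ (d j) (0<d j)
        V≈U : sum (λ j → u j * (u j * d j)) ≈ U
        V≈U = ∑-cong is∑ᴷ λ j → trans (*-congˡ (trans (*-comm _ _) (⁻¹-inverse (d j) (0<d j)))) (*-identityʳ _)
        4Um²≤1 : ι 4 * (U * (m * m)) ≤ 1#
        4Um²≤1 = *-cancelʳ-≤ (0<sum {K} 0<u) (≤-respˡ-≈
          (solve 2 (λ U m → (4 :× :1) :* (U :* m :* (U :* m)) := (4 :× :1) :* (U :* (m :* m)) :* U) refl U m)
          (≤-respʳ-≈ (trans V≈U (sym (*-identityˡ U)))
            (weighted-bound 0<p p<½ alg u (λ j → <⇒≤ (0<u j)) 0≤m)))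
        -- A positive divergence forces at least one round, so T α > 0 and Bernoulli's inequality
        -- bounds `D` below.
        0<D : 0# < D
        0<D = <-≤-trans (0<* (0<product-1⇒0<ι T (x some) (0<d some)) 0<α) Tα≤D
          where some = nonZero⇒Fin K
        scaled : ι 4 * (ι K * (m * m)) ≤ D
        scaled = ≤-trans (*-monoʳ-≤ (0<ι 4) (*-monoˡ-≤₀ 0≤m² (harmonic-bound 0<D 0<d)))
          (≤-respˡ-≈ (solve 3 (λ D U m → D :* ((4 :× :1) :* (U :* m))
                := (4 :× :1) :* (D :* U :* m)) refl D U (m * m))
            (≤-respʳ-≈ (*-identityʳ D) (*-monoʳ-≤₀ 0≤D 4Um²≤1)))

    minimax : minimaxBound p 0<p p<½ K T ≤ worstCaseError p alg
    minimax = ≤-by (0≤* (<⇒≤ 0<½) (≤⇒0≤- m≤r))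
      (trans (modulo ½+½≈1 (- worstCaseError p alg))
        (solve 3 (λ h r M → h :* (:1 :- r) :+ h :* (r :- (:1 :- (2 :× :1) :* M)) :+ :- M :* (h :+ h :- :1) := M)
        refl ½ r (worstCaseError p alg)))
      where
      0<2K = 0<* (0<ι 2) (0<ι K)
      X = 1# / (ι 2 * ι K) [ 0<2K ] * D
      r = √ X
      0≤X : 0# ≤ X
      0≤X = 0≤* (0≤* 0≤1 (<⇒≤ (0<⁻¹ _ 0<2K))) 0≤D
      X*2K≈D : X * (ι 2 * ι K) ≈ D
      X*2K≈D = trans (modulo (⁻¹-inverse (ι 2 * ι K) 0<2K) (- D))
        (solve 3 (λ i k D → :1 :* i :* D :* k :+ :- D :* (k :* i :- :1) := D) refl _ (ι 2 * ι K) D)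
      m≤r : m ≤ r
      m≤r = ≤-cases 0# m
        (λ 0<m → square-cancel-≤ (√-nonneg 0≤X) (≤-respʳ-≈ (sym (√-square 0≤X))
          (*-cancelʳ-≤ 0<2K (≤-respʳ-≈ (sym X*2K≈D) (≤-trans
            -- `minimax-square` yields m² ≤ D / (4 K); half of the left side is given up to reach
            -- the 1 / (2 K) of the statement.
            (≤-by (0≤* (0≤* (0≤ι 2) (0≤ι K)) 0≤m²)
              (solve 2 (λ K m → m :* m :* ((2 :× :1) :* K) :+ (2 :× :1) :* K :* (m :* m)
                 := (4 :× :1) :* (K :* (m :* m))) refl (ι K) m))
            (minimax-square (<⇒≤ 0<m)))))))
        (λ m≤0 → ≤-trans m≤0 (√-nonneg 0≤X))

    -- The part of the histories that never query j is common to P₀ and the law of j.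
    avoiding-j : ∀ j → m ≤ sum {T} λ t → π t j
    avoiding-j j = ≤-by (≤⇒0≤- (≤-trans
        (weierstrass {T} (λ t → π t j) (λ t → nonneg (sampling alg t) j) λ t →
          ≤-respʳ-≈ (total (sampling alg t)) (element≤sum (π t) (nonneg (sampling alg t)) j))
        (≤-trans (≤-respˡ-≈ mass (∑-mono is∑ common))
          (≤-respˡ-≈ (sym (∑-+ is∑ _ _)) (+-mono-≤
            (≤-respˡ-≈ (error-false 0<p p<½ alg) (maxᵛ-upper K _ (Vec.replicate K false)))
            (≤-respˡ-≈ (error-only 0<p p<½ alg j) (maxᵛ-upper K _ (only j))))))))
      (solve 2 (λ M s → :1 :- (2 :× :1) :* M :+ (M :+ M :- (:1 :- s)) := s) refl (worstCaseError p alg) _)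
      where
      P = P₀ 0<p p<½ alg
      q = Q 0<p p<½ alg
      Λⱼ = Λ 0<p p<½ alg (δ j)
      -- The indicator of the histories that never query j.
      N : History K T → Carrier
      N h = product λ t → 1# - δ j (proj₁ (lookup h t))

      mass : ∑ʰ K T (λ h → P h * N h) ≈ product λ t → 1# - π t j
      mass = trans (P₀-expectation 0<p p<½ alg λ t (k , y) → 1# - δ j k)
        (Product.sum-cong-≋ {T} λ t → trans
          (∑-cong is∑ᴷ λ k → solve 3 (λ π d p → π :* ((:1 :- p) :* (:1 :- d) :+ p :* (:1 :- d))
             := π :+ :- :1 :* (π :* d)) refl (π t k) (δ j k) p)
          (trans (∑-+ is∑ᴷ (π t) _) (trans (+-cong (total (sampling alg t))
            (trans (∑-* is∑ᴷ (- 1#) _) (*-congˡ (sum-δ (π t) j))))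
            (solve 1 (λ a → :1 :+ :- :1 :* a := :1 :- a) refl (π t j)))))

      0≤factor : ∀ h t → 0# ≤ 1# - δ j (proj₁ (lookup h t))
      0≤factor h t = ≤⇒0≤- (δ≤1 j (proj₁ (lookup h t)))

      PN≤P : ∀ h → P h * N h ≤ P h
      PN≤P h = ≤-respʳ-≈ (*-identityʳ (P h)) (*-monoʳ-≤₀ (0≤P₀ 0<p p<½ alg h)
        (≤-respʳ-≈ (product-1 {T} λ t → refl) (product-mono-≤ {T} (0≤factor h) λ t →
          ≤-by (0≤δ j (proj₁ (lookup h t)))
            (solve 1 (λ d → :1 :- d :+ d := :1) refl (δ j (proj₁ (lookup h t)))))))

      bsc-≤ : ∀ b y → bsc p false y * (1# - indicator b) ≤ bsc p b y
      bsc-≤ true  y = ≤-respˡ-≈ (sym (trans (*-congˡ (-‿inverseʳ 1#)) (zeroʳ _))) (0≤bsc 0<p p<½ true y)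
      bsc-≤ false y = ≈⇒≤ (solve 1 (λ b → b :* (:1 :- :0) := b) refl _)

      PN≤PΛ : ∀ h → P h * N h ≤ P h * Λⱼ h
      PN≤PΛ h = ≤-respˡ-≈ (Product.∑-distrib-+ {T} _ _) (≤-respʳ-≈ (Product.∑-distrib-+ {T} _ _)
        (product-mono-≤ {T}
          (λ t → 0≤* (0≤* (0≤π t (proj₁ (lookup h t))) (0≤bsc 0<p p<½ false (proj₂ (lookup h t))))
                    (0≤factor h t))
          λ t → let (k , y) = lookup h t; b = does (k Finₚ.≟ j) in
            ≤-respˡ-≈ (sym (*-assoc _ _ _)) (≤-respʳ-≈ (sym (*-assoc _ _ _))
              (*-monoʳ-≤₀ (0≤π t k) (≤-respʳ-≈ (bsc-ratio 0<p p<½ b y) (bsc-≤ b y))))))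
        where
        0≤π : ∀ t k → 0# ≤ π t k
        0≤π t = nonneg (sampling alg t)

      -- On a history without j, either output is an error for one of the two hypotheses; the output
      -- probabilities split the common mass accordingly.
      common : ∀ h → P h * N h ≤ P h * q h + P h * Λⱼ h * (1# - q h)
      common h = ≤-respˡ-≈ (solve 2 (λ x q → x :* q :+ x :* (:1 :- q) := x) refl (P h * N h) (q h))
        (+-mono-≤ (*-monoˡ-≤₀ (0≤Q 0<p p<½ alg h) (PN≤P h))
                  (*-monoˡ-≤₀ (≤⇒0≤- (Q≤1 0<p p<½ alg h)) (PN≤PΛ h)))

    -- Every j must receive expected number of queries at least m, and the T rounds provide T
    -- queries in total.
    coverage : ι K * m ≤ ι T
    coverage = ≤-respˡ-≈ (sum-const K m) (≤-respʳ-≈ counted (sum-mono-≤ {K} avoiding-j))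
      where
      counted : sum {K} (λ j → sum {T} λ t → π t j) ≈ ι T
      counted = trans (∑-comm {K} {T} _) (trans (∑-cong is∑ᵀ λ t → total (sampling alg t))
        (trans (sum-const T 1#) (*-identityʳ (ι T))))

    -- Query complexity

    -- Otherwise `exp-power-≤` would give (1 + D) to the power ν at most K, while Bernoulli makes it
    -- at least 1 + ν D ≥ 1 + K.
    log-bound : ∀ ν → ι K ≤ D * ι ν → log (ι K) (0<ι K) ≤ ι (T ℕ.* ν) * α
    log-bound ν K≤νD Nα<ℓ = ≤-trans (≤-trans (≤-trans
        (+-monoʳ-≤ 1# K≤νD) (+-monoʳ-≤ 1# (≈⇒≤ (*-comm D (ι ν)))))
        (bernoulli 0≤1+D ν))
      (≤-respˡ-≈ (trans (sym (^-assocʳ (1# + α) T ν)) (^-congˡ ν 1+D≈))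
        (exp-power-≤ (T ℕ.* ν) (<⇒≤ 0<α) (<⇒≤ Nα<ℓ) (exp-log (ι K) (0<ι K))))
      (<-respˡ-≈ (+-identityˡ (ι K)) (+-monoˡ-< (ι K) 0<1))
      where
      0≤1+D : 0# ≤ 1# + D
      0≤1+D = 0≤+ 0≤1 0≤D

    -- Multiply `log-bound` by K p. Then K α p = e² (1 / p + 1 / (1 - p)) p ≤ 2 e², and
    -- `entropy-gap` turns this into 16 (1 - H(p)).
    entropy-bound : ∀ ν → ι K ≤ D * ι ν → (0<1-H′ : 0# < 1# - H p 0<p p<½) →
      (ι K * log (ι K) (0<ι K) * p) / (1# - H p 0<p p<½) [ 0<1-H′ ] ≤ ι T * (ι 16 * ι ν)
    entropy-bound ν K≤νD 0<1-H′ = *-cancelʳ-≤ 0<1-H′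
      (≤-respˡ-≈ (sym (trans (modulo (⁻¹-inverse _ 0<1-H′) (- (ι K * logK * p)))
          (solve 3 (λ x h i → x :* i :* h :+ :- x :* (h :* i :- :1) := x) refl (ι K * logK * p) _ _)))
        (≤-trans (*-monoˡ-≤ 0<p (*-monoʳ-≤ (0<ι K) (log-bound ν K≤νD)))
        (≤-respˡ-≈ (sym regroup) (≤-trans (*-monoʳ-≤₀ 0≤Tν (≤-trans
            (*-monoʳ-≤₀ (0≤x² e) inverse-sum≤2) (*-monoˡ-≤₀ (0≤ι 2) (entropy-gap 0<p p<½))))
          (≈⇒≤ (solve 3 (λ T ν h → T :* ν :* ((8 :× :1) :* h :* (2 :× :1)) := T :* ((16 :× :1) :* ν) :* h)
            refl (ι T) (ι ν) (1# - H p 0<p p<½)))))))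
      where
      logK = log (ι K) (0<ι K)
      e = 1# - ι 2 * p
      i = p ⁻¹[ 0<p ]
      j = (1# - p) ⁻¹[ 0<q ]
      0≤Tν : 0# ≤ ι T * ι ν
      0≤Tν = 0≤* (0≤ι T) (0≤ι ν)
      regroup : ι K * (ι (T ℕ.* ν) * α) * p ≈ ι T * ι ν * (e * e * ((i + j) * p))
      regroup = trans (*-congʳ (*-congˡ (*-congʳ (×1-homo-* T ν))))
        (trans (solve 5 (λ K T ν α p → K :* (T :* ν :* α) :* p := T :* ν :* (K :* α :* p))
            refl (ι K) (ι T) (ι ν) α p)
          (*-congˡ (trans (*-congʳ Kα≈χ²) (*-assoc (e * e) (i + j) p))))
      inverse-sum≤2 : (i + j) * p ≤ ι 2
      inverse-sum≤2 = ≤-by (0≤* (<⇒≤ (0<e 0<p p<½)) (<⇒≤ (0<⁻¹ (1# - p) 0<q)))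
        (trans (modulo (⁻¹-inverse p 0<p) (- 1#)) (trans (modulo (⁻¹-inverse (1# - p) 0<q) (- 1#))
          (solve 3 (λ p i j → (i :+ j) :* p :+ (:1 :- (2 :× :1) :* p) :* j :+ :- :1 :* (p :* i :- :1)
            :+ :- :1 :* ((:1 :- p) :* j :- :1) := 2 :× :1) refl p i j)))

    -- K ≤ K (50 m)² = 625 · 4 K m² ≤ 625 D
    complexity : 1# ≤ ι 50 * m → (0<1-H′ : 0# < 1# - H p 0<p p<½) →
                 complexityBound p 0<p p<½ K 0<1-H′ ≤ ι T * (ι 16 * ι 625)
    complexity 1≤50m 0<1-H′ =
      proj₂ (proj₂ (⊔ʳ-supremum _ _)) _ K≤ (entropy-bound 625 K≤625D 0<1-H′)
      where
      0≤m : 0# ≤ m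
      0≤m = *-cancelʳ-≤ (0<ι 50) (≤-respˡ-≈ (sym (zeroˡ _)) (≤-trans 0≤1 (≤-respʳ-≈ (*-comm _ _) 1≤50m)))

      -- `coverage` gives K ≤ 50 T; the factor 50 is relaxed to the constant 16 · 625 of the entropy
      -- term.
      K≤ : ι K ≤ ι T * (ι 16 * ι 625)
      K≤ = ≤-trans (≤-respˡ-≈ (*-identityʳ (ι K)) (*-monoʳ-≤ (0<ι K) 1≤50m))
        (≤-respˡ-≈ (solve 3 (λ K c m → K :* m :* c := K :* (c :* m)) refl (ι K) (ι 50) m)
          (*-mono-≤ (0≤* (0≤ι K) 0≤m) coverage (0≤ι 50) (≤-trans
            (ι-mono (ℕₚ.≤ᵇ⇒≤ 50 625 tt))
            (≤-respˡ-≈ (*-identityˡ (ι 625)) (*-monoˡ-≤₀ (0≤ι 625)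
              (≤-by (0≤ι 15) refl))))))

      K≤625D : ι K ≤ D * ι 625
      K≤625D = ≤-trans
        (≤-respˡ-≈ (solve 1 (λ K → K :* (:1 :* :1) := K) refl (ι K))
          (*-monoʳ-≤ (0<ι K) (*-mono-≤ 0≤1 1≤50m 0≤1 1≤50m)))
        (≤-respˡ-≈ (trans (solve 3 (λ K m c → (4 :× :1) :* (K :* (m :* m)) :* (c :* c)
              := K :* ((2 :× :1) :* c :* m :* ((2 :× :1) :* c :* m))) refl (ι K) m (ι 25))
            (*-congˡ (*-cong 50≈ 50≈)))
          (≤-respʳ-≈ (*-congˡ (sym (×1-homo-* 25 25)))
            (*-monoˡ-≤₀ (0≤* (0≤ι 25) (0≤ι 25)) (minimax-square 0≤m))))
        where
        50≈ : ι 2 * ι 25 * m ≈ ι 50 * m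
        50≈ = *-congʳ (sym (×1-homo-* 2 25))

    -- At error 49/100 the quantity 1 - 2 · error equals 1/50.
    error-gap : ∀ {δ} → δ < ι 49 / ι 100 [ 0<ι 100 ] → worstCaseError p alg ≤ δ → 1# ≤ ι 50 * m
    error-gap {δ} δ<49% M≤δ = ≤-by (≤⇒0≤- 100M≤49) (trans (modulo (×1-homo-* 50 2) M)
      (solve 3 (λ k h M → :1 :+ (k :- h :* M) :+ M :* (h :- (:1 :+ k) :* (2 :× :1))
         := (:1 :+ k) :* (:1 :- (2 :× :1) :* M)) refl (ι 49) (ι 100) M))
      where
      M = worstCaseError p alg
      100M≤49 : ι 100 * M ≤ ι 49
      100M≤49 = ≤-trans (*-monoʳ-≤ (0<ι 100) (≤-trans M≤δ (<⇒≤ δ<49%)))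
        (≈⇒≤ (trans (solve 3 (λ h k i → h :* (k :* i) := k :* (h :* i)) refl (ι 100) (ι 49) _)
          (trans (*-congˡ (⁻¹-inverse (ι 100) (0<ι 100))) (*-identityʳ (ι 49)))))

mainTheorem2 : ∀ {c ℓ} (ℝ : Reals c ℓ) →
    let open NoisyOR ℝ in
    (∀ (K T : ℕ) .{{_ : NonZero K}} (p : Carrier) (0<p : 0# < p) (p<½ : p < ½) →
    minimaxBound p 0<p p<½ K T ≤inf λ (alg : NonAdaptive K T) → worstCaseError p alg)
    ×
    (∃[ a ] (0# < a ×
    (∀ (K T : ℕ) .{{_ : NonZero K}} (p δ : Carrier) (0<p : 0# < p) (p<½ : p < ½) →
    0# < δ → δ < ι 49 / ι 100 [ 0<ι 100 ] →
    (alg : NonAdaptive K T) → worstCaseError p alg ≤ δ →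
    Σ[ 0<1-H ∈ 0# < 1# - H p 0<p p<½ ]
    a * complexityBound p 0<p p<½ K 0<1-H ≤ ι T)))
mainTheorem2 ℝ = (λ K T p 0<p p<½ alg → minimax 0<p p<½ alg) ,
  scale ⁻¹[ 0<scale ] , 0<⁻¹ scale 0<scale , λ K T p δ 0<p p<½ 0<δ δ<49% alg M≤δ →
    0<1-H 0<p p<½ , *-cancelʳ-≤ 0<scale (≤-respˡ-≈
      (sym (trans (*-comm _ _) (trans (sym (*-assoc _ _ _))
        (trans (*-congʳ (⁻¹-inverse scale 0<scale)) (*-identityˡ _)))))
      (complexity 0<p p<½ alg (error-gap 0<p p<½ alg δ<49% M≤δ) (0<1-H 0<p p<½)))
  where
  open NoisyOR ℝ
  open Log2 ℝ
  open OrderProperties ℝ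
  open EntropyGap ℝ
  open LowerBound ℝ
  -- The universal constant is the inverse of this, 1/10000.
  scale : Carrier
  scale = ι 16 * ι 625
  0<scale : 0# < scale
  0<scale = 0<* (0<ι 16) (0<ι 625)
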